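{- Let $a,b\in\mathbb{N}_0$ with $a+b\neq 0$ and let $\mathbf{c}=(c_1,c_2,\dots)$ be a sequence with $c_j\in\mathbb{N}_0$ for all $j\ge 1$. Let $y_n=\left|\mathfrak{D}^{\mathbf{c}}_n(a,b)\right|$ for $n\ge 1$, where $\mathfrak{D}^{\mathbf{c}}_n(a,b)$ is the set of colored Dyck words of semilength $(a+b)n$ defined in the context. Then for every $n\ge 1$, $$y_n=\sum_{k=1}^n\binom{an+bk}{k-1}\frac{(k-1)!}{n!}\,B_{n,k}(1!c_1,2!c_2,\dots),$$ where $B_{n,k}$ is the $(n,k)$-th partial Bell polynomial. Moreover, for every $n\ge 1$ and $1\le k\le n$, the quantity $$\binom{an+bk}{k-1}\frac{(k-1)!}{n!}\,B_{n,k}(1!c_1,2!c_2,\dots)$$ is the number of elements of $\mathfrak{D}^{\mathbf{c}}_n(a,b)$ having exactly $k$ peaks.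
   Context: $\mathbb{N}_0=\{0,1,2,\dots\}$. A Dyck word of semilength $m$ is a word in the letters $u$ and $d$ with exactly $m$ letters $u$ and $m$ letters $d$, such that every prefix contains at least as many $u$'s as $d$'s (it encodes a lattice path from $(0,0)$ to $(2m,0)$ staying in the first quadrant, with up-steps $u=(1,1)$ and down-steps $d=(1,-1)$). A peak is an occurrence of $ud$ as two consecutive letters. For $a,b\in\mathbb{N}_0$ with $a+b\ne 0$, $\mathbf{c}=(c_1,c_2,\dots)$ with $c_j\in\mathbb{N}_0$, and $n\ge 1$, the set $\mathfrak{D}^{\mathbf{c}}_n(a,b)$ consists of the Dyck words of semilength $(a+b)n$ that are concatenations of strings of the form $P_0=d$ and $P_j=u^{(a+b)j}d^{\,b(j-1)+1}$ for $j=1,\dots,n$ (each usable any number of times, in any order), such that each maximal $(a+b)j$-ascent substring $u^{(a+b)j}$ (maximal run of consecutive $u$'s, of length $(a+b)j$) is colored in one of $c_j$ different ways; $c_j=0$ means that maximal ascents of length $(a+b)j$ are not allowed. Elements of $\mathfrak{D}^{\mathbf{c}}_n(a,b)$ are words together with a choice of color for each maximal ascent; two elements are equal only if both the words and the colors agree. (Since each $P_j$ with $j\ge1$ ends in at least one $d$, the maximal ascents of such a word are exactly the blocks $u^{(a+b)j}$ of the strings $P_j$, $j\ge 1$, that occur.) For $1\le k\le n$, the $(n,k)$-th partial Bell polynomial is $$B_{n,k}(x_1,\dots,x_{n-k+1})=\sum_{\alpha\in\pi(n,k)}\frac{n!}{\alpha_1!\cdots\alpha_{n-k+1}!}\left(\frac{x_1}{1!}\right)^{\alpha_1}\cdots\left(\frac{x_{n-k+1}}{(n-k+1)!}\right)^{\alpha_{n-k+1}},$$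 where $\pi(n,k)$ is the set of $\alpha\in\mathbb{N}_0^{n-k+1}$ with $\alpha_1+\cdots+\alpha_{n-k+1}=k$ and $\alpha_1+2\alpha_2+\cdots+(n-k+1)\alpha_{n-k+1}=n$. The notation $B_{n,k}(1!c_1,2!c_2,\dots)$ means $x_j=j!\,c_j$ for $1\le j\le n-k+1$. -}

module Defs where

open import Data.Nat using (ℕ; zero; suc; _+_; _*_; _∸_; _≤_; _!; NonZero) renaming (_/_ to _div_)
open import Data.Nat.Properties using (_!≢0; m*n≢0; _≟_)
open import Data.Nat.Combinatorics using (_C_)
open import Data.Integer using (+_)
open import Data.Rational using (ℚ; 0ℚ; _/_; +-*-rawSemiring) renaming (_+_ to _+ℚ_; _*_ to _*ℚ_)
open import Algebra.Definitions.RawSemiring +-*-rawSemiring using (_^_; product)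
open import Data.Fin using (Fin; toℕ)
open import Data.Vec as Vec using (Vec; []; _∷_; lookup; tabulate)
open import Data.List using (List; []; _∷_; _++_; replicate; concatMap; length; filter; cartesianProductWith; upTo; foldr; map)
open import Data.List.Relation.Unary.All using (All)
open import Data.Product using (Σ; Σ-syntax; _,_; proj₁)
open import Function using (_∘_; Inverse)
open import Level using (0ℓ)
open import Relation.Binary using (Setoid; DecidableEquality)
open import Relation.Binary.PropositionalEquality using (_≡_; refl; setoid)
open import Relation.Nullary using (yes; no; _×-dec_)
import Relation.Binary.Construct.On as On

data Step : Set where
  u d : Step

_≟ˢ_ : DecidableEquality Step
u ≟ˢ u = yes refl
u ≟ˢ d = no λ ()
d ≟ˢ u = no λ ()
d ≟ˢ d = yes refl

#u #d : List Step → ℕ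
#u = length ∘ filter (_≟ˢ u)
#d = length ∘ filter (_≟ˢ d)

record IsDyck (m : ℕ) (w : List Step) : Set where
  field
    ups    : #u w ≡ m
    downs  : #d w ≡ m
    prefix : ∀ p q → p ++ q ≡ w → #d p ≤ #u p

peaks : List Step → ℕ
peaks []          = 0
peaks (u ∷ d ∷ w) = suc (peaks (d ∷ w))
peaks (_ ∷ w)     = peaks w

-- ascentsAfter r w lists the lengths, from left to right, of the maximal runs
-- of u's in the word consisting of r letters u followed by w.
ascentsAfter : ℕ → List Step → List ℕ
ascentsAfter zero    []      = []
ascentsAfter (suc r) []      = suc r ∷ []
ascentsAfter r       (u ∷ w) = ascentsAfter (suc r) w
ascentsAfter zero    (d ∷ w) = ascentsAfter zero w
ascentsAfter (suc r) (d ∷ w) = suc r ∷ ascentsAfter zero w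

ascents : List Step → List ℕ
ascents = ascentsAfter 0

-- In P_{j+1} the exponent b((j+1) - 1) + 1 is written b j + 1.
P : (a b : ℕ) → ℕ → List Step
P a b zero    = d ∷ []
P a b (suc j) = replicate ((a + b) * suc j) u ++ replicate (b * j + 1) d

IsConcat : (a b n : ℕ) → List Step → Set
IsConcat a b n w = Σ[ js ∈ List (Fin (suc n)) ] concatMap (P a b ∘ toℕ) js ≡ w

-- One colour for each maximal ascent: an ascent of length ℓ = (a + b) j has
-- c j colours.  In a concatenation of the strings P a b j every ascent has such a
-- length with j ≥ 1, so the division is exact and c 0 is never used.
Colouring : (a b : ℕ) .{{_ : NonZero (a + b)}} → (ℕ → ℕ) → List Step → Set
Colouring a b c w = All (λ ℓ → Fin (c (ℓ div (a + b)))) (ascents w)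

record ColouredDyckWord (a b : ℕ) .{{_ : NonZero (a + b)}} (c : ℕ → ℕ) (n : ℕ) : Set where
  field
    word      : List Step
    dyck      : IsDyck ((a + b) * n) word
    blocks    : IsConcat a b n word
    colouring : Colouring a b c word

open ColouredDyckWord public

module _ (a b : ℕ) .{{_ : NonZero (a + b)}} (c : ℕ → ℕ) (n : ℕ) where

  -- Elements are compared by their word and colours only, not by the proofs
  -- that the word is admissible.
  wordAndColours : ColouredDyckWord a b c n → Σ (List Step) (Colouring a b c)
  wordAndColours w = word w , colouring w

  𝔇 : Setoid 0ℓ 0ℓ
  𝔇 = On.setoid (setoid (Σ (List Step) (Colouring a b c))) wordAndColours

  𝔇-withPeaks : ℕ → Setoid 0ℓ 0ℓ
  𝔇-withPeaks k = On.setoid 𝔇 (proj₁ {B = λ w → peaks (word w) ≡ k})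

HasCardinality : Setoid 0ℓ 0ℓ → ℕ → Set
HasCardinality S m = Inverse (setoid (Fin m)) S

fromℕ : ℕ → ℚ
fromℕ m = + m / 1

∏! : ∀ {m} → Vec ℕ m → ℕ
∏! []      = 1
∏! (x ∷ α) = x ! * ∏! α

∏!≢0 : ∀ {m} (α : Vec ℕ m) → NonZero (∏! α)
∏!≢0 []      = _
∏!≢0 (x ∷ α) = m*n≢0 (x !) (∏! α) {{x !≢0}} {{∏!≢0 α}}

weight : ∀ {m} → Vec ℕ m → ℕ
weight α = Vec.sum (tabulate λ i → suc (toℕ i) * lookup α i)

boundedVecs : (N m : ℕ) → List (Vec ℕ m)
boundedVecs N zero    = [] ∷ []
boundedVecs N (suc m) = cartesianProductWith _∷_ (upTo (suc N)) (boundedVecs N m)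

-- Entries summing to k are at most k, so a finite search finds all of π(n,k).
-- The entry of α at position i is α_{i+1}.
π : (n k : ℕ) → List (Vec ℕ (suc (n ∸ k)))
π n k = filter (λ α → (Vec.sum α ≟ k) ×-dec (weight α ≟ n)) (boundedVecs k (suc (n ∸ k)))

-- The argument x is indexed as in x_1, x_2, …; x 0 is not used.
bellTerm : (n : ℕ) (x : ℕ → ℚ) {m : ℕ} → Vec ℕ m → ℚ
bellTerm n x α =
  (_/_ (+ (n !)) (∏! α) {{∏!≢0 α}}) *ℚ product (λ i → x/! (suc (toℕ i)) ^ lookup α i)
  where
  x/! : ℕ → ℚ
  x/! j = x j *ℚ (_/_ (+ 1) (j !) {{j !≢0}})

Bell : (n k : ℕ) → (ℕ → ℚ) → ℚ
Bell n k x = foldr _+ℚ_ 0ℚ (map (bellTerm n x) (π n k))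

summand : (a b : ℕ) (c : ℕ → ℕ) (n k : ℕ) → ℚ
summand a b c n k =
  fromℕ ((a * n + b * k) C (k ∸ 1))
    *ℚ (_/_ (+ ((k ∸ 1) !)) (n !) {{n !≢0}})
    *ℚ Bell n k (λ j → fromℕ (j ! * c j))

{-# OPTIONS --safe #-}

-- Reading a word block by block gives a walk on heights: P_0 lowers the height by 1 and
-- P_j, j ≥ 1, raises it by aj + b - 1.  Let W(n,k) be the number of coloured compositions
-- of n into k parts.  The walks from height H - 1 down to 0 with k blocks P_j, j ≥ 1, of
-- total index n satisfy a recursion on the first block, whose solution is
-- (H/k) C(H + an + bk - 1, k - 1) W(n,k); besides Pascal's rule this needs only that
-- each of the k parts has the same share in the total n.  The theorem is the case H = 1,
-- because k!/n! B_{n,k}(1!c_1, 2!c_2, …) = W(n,k).  The latter follows by induction on k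
-- from Euler's identity for the degree-k part of the product of the series exp(c_j x_j).
module Submission where

open import Defs

-- A block `P_j` with `j ≥ 1` climbs before it falls and, since `a + b ≠ 0`, ends no lower than it
-- began. So only `P_0` can violate the Dyck condition, and heights at block boundaries suffice.
-- Such a block also has exactly one peak and ends in `d`, which is why k counts peaks. Every start
-- height is needed because a block changes the height. A walk from height H - 1 has H - 1 + an + bk
-- blocks in all, and removing the first one lowers this number by one whichever kind it is. Hence
-- both branches of the recursion carry binomials with the same upper index, and Pascal's rule can
-- merge them. The obstacle is that the height after a jump depends on the individual part, whereas
-- the binomial sees only the total; this is what the symmetry of the parts repairs. With L = H + an
-- + bk the closed form equals (H/L) C(L, k) W(n,k), the ballot factor of the cycle lemma. The Bell
-- polynomial is a finite sum, so Euler's identity is applied to exponential series cut off at a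
-- degree N, against test functions that vanish above N.

-- Coloured compositions and the closed form for the number of walks.

module Compositions where

  open import Data.Nat using (ℕ; zero; suc; pred; _+_; _*_; _∸_; _≤_; _≤′_; ≤′-refl; ≤′-step; z≤n; s≤s; NonZero)
  open import Data.Nat.Properties
  open import Data.Nat.Combinatorics using (_C_; nC1≡n; nCk+nC[k+1]≡[n+1]C[k+1])
  open import Data.Nat.Tactic.RingSolver using (solve-∀)
  open import Data.Fin using (Fin; zero; suc; toℕ)
  open import Data.Fin.Properties using (toℕ-inject₁; toℕ-fromℕ)
  open import Relation.Nullary using (yes; no; contradiction)
  open import Function using (_∘_)
  open import Relation.Binary.PropositionalEquality
  open import Algebra.Properties.Semiring.Sum +-*-semiring
    using (sum-cong-≗; ∑-distrib-+; ∑-comm; *-distribˡ-sum; sum-init-last)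
    renaming (sum to ∑)

  open ≡-Reasoning

  shift : ∀ {ℓ} {A : Set ℓ} → ℕ → (ℕ → A) → (ℕ → A)
  shift p φ q = φ (p + q)

  module _ (c : ℕ → ℕ) (m : ℕ) where

    opaque

      -- The index i stands for a part of size i + 1.
      sumParts : (ℕ → ℕ) → ℕ
      sumParts f = ∑ {m} λ j → c (suc (toℕ j)) * f (toℕ j)

      sumParts-cong : ∀ {f g} → (∀ i → f i ≡ g i) → sumParts f ≡ sumParts g
      sumParts-cong f≗g = sum-cong-≗ {m} λ j → cong (c (suc (toℕ j)) *_) (f≗g (toℕ j))

      sumParts-linear : ∀ f g x y → sumParts (λ i → x * f i + y * g i) ≡ x * sumParts f + y * sumParts g
      sumParts-linear f g x y = begin
        sumParts (λ i → x * f i + y * g i)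
          ≡⟨ sum-cong-≗ {m} (λ j → rearrange (c (suc (toℕ j))) (f (toℕ j)) (g (toℕ j)) x y) ⟩
        ∑ {m} (λ j → x * F j + y * G j)
          ≡⟨ ∑-distrib-+ {m} (λ j → x * F j) (λ j → y * G j) ⟩
        ∑ {m} (λ j → x * F j) + ∑ {m} (λ j → y * G j)
          ≡⟨ cong₂ _+_ (*-distribˡ-sum x F) (*-distribˡ-sum y G) ⟨
        x * sumParts f + y * sumParts g ∎
        where
        F G : Fin m → ℕ
        F j = c (suc (toℕ j)) * f (toℕ j)
        G j = c (suc (toℕ j)) * g (toℕ j)
        rearrange : ∀ v f g x y → v * (x * f + y * g) ≡ x * (v * f) + y * (v * g)
        rearrange = solve-∀

      sumParts-comm : ∀ (f : ℕ → ℕ → ℕ) →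
        sumParts (λ i → sumParts (λ i′ → f i i′)) ≡ sumParts (λ i′ → sumParts (λ i → f i i′))
      sumParts-comm f = begin
        ∑ {m} (λ j → v j * ∑ {m} (λ j′ → v j′ * f (toℕ j) (toℕ j′)))
          ≡⟨ sum-cong-≗ {m} (λ j → *-distribˡ-sum {m} (v j) (λ j′ → v j′ * f (toℕ j) (toℕ j′))) ⟩
        ∑ {m} (λ j → ∑ {m} (λ j′ → v j * (v j′ * f (toℕ j) (toℕ j′))))
          ≡⟨ ∑-comm {m} {m} (λ j j′ → v j * (v j′ * f (toℕ j) (toℕ j′))) ⟩
        ∑ {m} (λ j′ → ∑ {m} (λ j → v j * (v j′ * f (toℕ j) (toℕ j′))))
          ≡⟨ sum-cong-≗ {m} (λ j′ → sum-cong-≗ {m} (λ j → rearrange (v j) (v j′) (f (toℕ j) (toℕ j′)))) ⟩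
        ∑ {m} (λ j′ → ∑ {m} (λ j → v j′ * (v j * f (toℕ j) (toℕ j′))))
          ≡⟨ sum-cong-≗ {m} (λ j′ → *-distribˡ-sum {m} (v j′) (λ j → v j * f (toℕ j) (toℕ j′))) ⟨
        ∑ {m} (λ j′ → v j′ * ∑ {m} (λ j → v j * f (toℕ j) (toℕ j′))) ∎
        where
        v : Fin m → ℕ
        v j = c (suc (toℕ j))
        rearrange : ∀ x y z → x * (y * z) ≡ y * (x * z)
        rearrange = solve-∀

    sumParts-* : ∀ f x → sumParts (λ i → x * f i) ≡ x * sumParts f
    sumParts-* f x = begin
      sumParts (λ i → x * f i)           ≡⟨ sumParts-cong (λ i → +-identityʳ (x * f i)) ⟨
      sumParts (λ i → x * f i + 0 * f i) ≡⟨ sumParts-linear f f x 0 ⟩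
      x * sumParts f + 0                 ≡⟨ +-identityʳ _ ⟩
      x * sumParts f                     ∎

    sumParts-+ : ∀ f g → sumParts (λ i → f i + g i) ≡ sumParts f + sumParts g
    sumParts-+ f g = begin
      sumParts (λ i → f i + g i)         ≡⟨ sumParts-cong (λ i → cong₂ _+_ (*-identityˡ (f i)) (*-identityˡ (g i))) ⟨
      sumParts (λ i → 1 * f i + 1 * g i) ≡⟨ sumParts-linear f g 1 1 ⟩
      1 * sumParts f + 1 * sumParts g    ≡⟨ cong₂ _+_ (*-identityˡ (sumParts f)) (*-identityˡ (sumParts g)) ⟩
      sumParts f + sumParts g            ∎

    -- Testing the total of the k parts with a function φ, instead of fixing it, avoids
    -- subtraction in the recursion; φ = δ n recovers the compositions of n.
    compositions : ℕ → (ℕ → ℕ) → ℕ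
    compositions zero    φ = φ 0
    compositions (suc k) φ = sumParts λ i → compositions k (shift (suc i) φ)

    compositions-cong : ∀ k {φ ψ : ℕ → ℕ} → (∀ q → φ q ≡ ψ q) → compositions k φ ≡ compositions k ψ
    compositions-cong zero    φ≗ψ = φ≗ψ 0
    compositions-cong (suc k) φ≗ψ = sumParts-cong λ i → compositions-cong k (λ q → φ≗ψ (suc i + q))

    compositions-linear : ∀ k (φ ψ : ℕ → ℕ) x y →
      compositions k (λ q → x * φ q + y * ψ q) ≡ x * compositions k φ + y * compositions k ψ
    compositions-linear zero    φ ψ x y = refl
    compositions-linear (suc k) φ ψ x y = trans
      (sumParts-cong λ i → compositions-linear k (shift (suc i) φ) (shift (suc i) ψ) x y)
      (sumParts-linear _ _ x y)

    compositions-* : ∀ k (φ : ℕ → ℕ) x → compositions k (λ q → x * φ q) ≡ x * compositions k φ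
    compositions-* k φ x = begin
      compositions k (λ q → x * φ q)           ≡⟨ compositions-cong k (λ q → +-identityʳ (x * φ q)) ⟨
      compositions k (λ q → x * φ q + 0 * φ q) ≡⟨ compositions-linear k φ φ x 0 ⟩
      x * compositions k φ + 0                 ≡⟨ +-identityʳ _ ⟩
      x * compositions k φ                     ∎

    firstPart : ℕ → (ℕ → ℕ) → ℕ
    firstPart k φ = sumParts λ i → suc i * compositions k (shift (suc i) φ)

    -- By symmetry every one of the k + 1 parts contributes as much to the total as the first.
    compositions-weight : ∀ k φ → compositions (suc k) (λ q → q * φ q) ≡ suc k * firstPart k φ
    compositions-weight k φ = begin
      sumParts (λ i → compositions k (λ q → (suc i + q) * φ (suc i + q)))
        ≡⟨ sumParts-cong (λ i → split (suc i)) ⟩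
      sumParts (λ i → suc i * compositions k (shift (suc i) φ) + compositions k (λ q → q * φ (suc i + q)))
        ≡⟨ sumParts-+ _ _ ⟩
      firstPart k φ + sumParts (λ i → compositions k (λ q → q * φ (suc i + q)))
        ≡⟨ cong (firstPart k φ +_) (rest k φ) ⟩
      firstPart k φ + k * firstPart k φ ∎
      where
      split : ∀ p → compositions k (λ q → (p + q) * φ (p + q)) ≡
        p * compositions k (shift p φ) + compositions k (λ q → q * φ (p + q))
      split p = begin
        compositions k (λ q → (p + q) * φ (p + q))
          ≡⟨ compositions-cong k (λ q → rearrange p q (φ (p + q))) ⟩
        compositions k (λ q → p * φ (p + q) + 1 * (q * φ (p + q)))
          ≡⟨ compositions-linear k (shift p φ) (λ q → q * φ (p + q)) p 1 ⟩
        p * compositions k (shift p φ) + 1 * compositions k (λ q → q * φ (p + q))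
          ≡⟨ cong (p * compositions k (shift p φ) +_) (*-identityˡ _) ⟩
        p * compositions k (shift p φ) + compositions k (λ q → q * φ (p + q)) ∎
        where
        rearrange : ∀ p q x → (p + q) * x ≡ p * x + 1 * (q * x)
        rearrange = solve-∀
      -- The parts after the first: the weight lemma for one part fewer expresses their share by
      -- that of the second part, and exchanging the first two parts turns it into the share of the
      -- first.
      rest : ∀ k φ → sumParts (λ i → compositions k (λ q → q * φ (suc i + q))) ≡ k * firstPart k φ
      rest zero    φ = sumParts-* (λ _ → 0) 0
      rest (suc k) φ = begin
        sumParts (λ i → compositions (suc k) (λ q → q * φ (suc i + q)))
          ≡⟨ sumParts-cong (λ i → compositions-weight k (shift (suc i) φ)) ⟩
        sumParts (λ i → suc k * firstPart k (shift (suc i) φ))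
          ≡⟨ sumParts-* _ (suc k) ⟩
        suc k * sumParts (λ i → sumParts (λ i′ → suc i′ * compositions k (λ q → φ (suc i + (suc i′ + q)))))
          ≡⟨ cong (suc k *_) (sumParts-comm _) ⟩
        suc k * sumParts (λ i′ → sumParts (λ i → suc i′ * compositions k (λ q → φ (suc i + (suc i′ + q)))))
          ≡⟨ cong (suc k *_) (sumParts-cong (λ i′ → trans (sumParts-* _ (suc i′))
               (cong (suc i′ *_) (sumParts-cong λ i → compositions-cong k λ q → cong φ (swap (suc i) (suc i′) q))))) ⟩
        suc k * firstPart (suc k) φ ∎
        where
        swap : ∀ x y z → x + (y + z) ≡ y + (x + z)
        swap = solve-∀

    -- Every part is at least 1, so `φ` is tested only at totals of at least `k`.
    compositions-zero : ∀ k φ → (∀ q → k ≤ q → φ q ≡ 0) → compositions k φ ≡ 0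
    compositions-zero zero    φ φ≡0 = φ≡0 0 z≤n
    compositions-zero (suc k) φ φ≡0 = trans
      (sumParts-cong λ i → compositions-zero k (shift (suc i) φ) λ q k≤q → φ≡0 (suc i + q) (s≤s (m≤n⇒m≤o+n i k≤q)))
      (sumParts-* (λ _ → 0) 0)

  module _ (c : ℕ → ℕ) where

    opaque
      unfolding sumParts

      sumParts-suc : ∀ m f → sumParts c (suc m) f ≡ sumParts c m f + c (suc m) * f m
      sumParts-suc m f = trans (sum-init-last {m} (λ j → g (toℕ j)))
        (cong₂ _+_ (sum-cong-≗ {m} λ j → cong g (toℕ-inject₁ j)) (cong g (toℕ-fromℕ m)))
        where
        g : ℕ → ℕ
        g i = c (suc i) * f i

    -- If one of `suc k` parts has size `m + 1`, the other `k` push the total to at least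
    -- `m + suc k`, where `φ` vanishes.
    compositions-suc : ∀ m k φ → (∀ q → m + k ≤ q → φ q ≡ 0) →
      compositions c (suc m) k φ ≡ compositions c m k φ
    compositions-suc m zero    φ φ≡0 = refl
    compositions-suc m (suc k) φ φ≡0 = begin
      sumParts c (suc m) (λ i → compositions c (suc m) k (shift (suc i) φ))
        ≡⟨ sumParts-cong c (suc m) (λ i → compositions-suc m k (shift (suc i) φ) (bound i)) ⟩
      sumParts c (suc m) (λ i → compositions c m k (shift (suc i) φ))
        ≡⟨ sumParts-suc m _ ⟩
      compositions c m (suc k) φ + c (suc m) * compositions c m k (shift (suc m) φ)
        ≡⟨ cong (λ x → compositions c m (suc k) φ + c (suc m) * x) (compositions-zero c m k _ last≡0) ⟩
      compositions c m (suc k) φ + c (suc m) * 0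
        ≡⟨ cong (compositions c m (suc k) φ +_) (*-zeroʳ (c (suc m))) ⟩
      compositions c m (suc k) φ + 0
        ≡⟨ +-identityʳ _ ⟩
      compositions c m (suc k) φ ∎
      where
      bound : ∀ i q → m + k ≤ q → φ (suc i + q) ≡ 0
      bound i q m+k≤q = φ≡0 (suc i + q) (subst (_≤ suc i + q) (sym (+-suc m k)) (s≤s (m≤n⇒m≤o+n i m+k≤q)))
      last≡0 : ∀ q → k ≤ q → φ (suc m + q) ≡ 0
      last≡0 q k≤q = φ≡0 (suc m + q) (subst (_≤ suc m + q) (sym (+-suc m k)) (s≤s (+-monoʳ-≤ m k≤q)))

    -- The largest part of a composition of n into k parts is at most n ∸ k + 1.
    compositions-truncate : ∀ k φ {m m′} → m ≤ m′ → (∀ q → m + k ≤ q → φ q ≡ 0) →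
      compositions c m′ k φ ≡ compositions c m k φ
    compositions-truncate k φ {m} m≤m′ φ≡0 = go (≤⇒≤′ m≤m′)
      where
      go : ∀ {m′} → m ≤′ m′ → compositions c m′ k φ ≡ compositions c m k φ
      go ≤′-refl                 = refl
      go (≤′-step {m′} m≤′m′) = trans
        (compositions-suc m′ k φ λ q m′+k≤q → φ≡0 q (≤-trans (+-monoˡ-≤ k (≤′⇒≤ m≤′m′)) m′+k≤q))
        (go m≤′m′)

  -- Kronecker's delta by recursion instead of by a decision, so that `δ (suc k) (suc p)` reduces to
  -- `δ k p`: lowering a degree by one then holds by computation.
  δ : ℕ → ℕ → ℕ
  δ zero    zero    = 1
  δ zero    (suc q) = 0
  δ (suc n) zero    = 0
  δ (suc n) (suc q) = δ n q

  δ-refl : ∀ n → δ n n ≡ 1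
  δ-refl zero    = refl
  δ-refl (suc n) = δ-refl n

  δ-≢ : ∀ {n q} → n ≢ q → δ n q ≡ 0
  δ-≢ {zero}  {zero}  n≢q = contradiction refl n≢q
  δ-≢ {zero}  {suc q} n≢q = refl
  δ-≢ {suc n} {zero}  n≢q = refl
  δ-≢ {suc n} {suc q} n≢q = δ-≢ (n≢q ∘ cong suc)

  -- Freezes a coefficient that depends on the total, such as a binomial, so that it can leave the
  -- sum.
  *-δ : ∀ (f : ℕ → ℕ) n q → f q * δ n q ≡ f n * δ n q
  *-δ f n q with n ≟ q
  ... | yes refl = refl
  ... | no n≢q rewrite δ-≢ n≢q = trans (*-zeroʳ (f q)) (sym (*-zeroʳ (f n)))

  absorption : ∀ n k → suc k * (suc n C suc k) ≡ suc n * (n C k)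
  absorption n       zero    = trans (+-identityʳ _) (trans (nC1≡n (suc n)) (sym (*-identityʳ (suc n))))
  absorption zero    (suc k) = *-zeroʳ (suc (suc k))
  absorption (suc n) (suc k) = begin
    suc (suc k) * (suc (suc n) C suc (suc k))
      ≡⟨ cong (suc (suc k) *_) (nCk+nC[k+1]≡[n+1]C[k+1] (suc n) (suc k)) ⟨
    suc (suc k) * ((suc n C suc k) + (suc n C suc (suc k)))
      ≡⟨ *-distribˡ-+ (suc (suc k)) (suc n C suc k) (suc n C suc (suc k)) ⟩
    (suc n C suc k) + suc k * (suc n C suc k) + suc (suc k) * (suc n C suc (suc k))
      ≡⟨ cong₂ (λ x y → (suc n C suc k) + x + y) (absorption n k) (absorption n (suc k)) ⟩
    (suc n C suc k) + suc n * (n C k) + suc n * (n C suc k)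
      ≡⟨ +-assoc (suc n C suc k) (suc n * (n C k)) _ ⟩
    (suc n C suc k) + (suc n * (n C k) + suc n * (n C suc k))
      ≡⟨ cong ((suc n C suc k) +_) (*-distribˡ-+ (suc n) (n C k) (n C suc k)) ⟨
    (suc n C suc k) + suc n * ((n C k) + (n C suc k))
      ≡⟨ cong (λ x → (suc n C suc k) + suc n * x) (nCk+nC[k+1]≡[n+1]C[k+1] n k) ⟩
    suc (suc n) * (suc n C suc k) ∎

  -- Pascal's rule merges `suc k * H` copies of the two binomials, and absorption turns
  -- `L * ((L ∸ 1) C k)` into `suc k * (L C suc k)`. In the recursion `L` is the number of blocks of
  -- the walk and `L ∸ 1` what remains after the first.
  binomial-step : ∀ k H r → let L = H + r in
    suc k * (H * ((L ∸ 1) C suc k)) + (L + suc k * H) * ((L ∸ 1) C k) ≡ suc k * (suc H * (L C suc k))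
  binomial-step k H r with H + r in eq
  -- Here `L ∸ 1` is 0 and not -1; this does no harm, because `H` and `L` vanish as well and so does
  -- `0 C suc k`.
  ... | zero rewrite m+n≡0⇒m≡0 H eq = trans (cong₂ (λ x y → x + y * (0 C k)) (*-zeroʳ k) (*-zeroʳ k)) (sym (*-zeroʳ k))
  ... | suc M = begin
    suc k * (H * (M C suc k)) + (suc M + suc k * H) * (M C k)
      ≡⟨ rearrange k H M (M C suc k) (M C k) ⟩
    suc k * (H * ((M C k) + (M C suc k))) + suc M * (M C k)
      ≡⟨ cong₂ (λ x y → suc k * (H * x) + y) (nCk+nC[k+1]≡[n+1]C[k+1] M k) (sym (absorption M k)) ⟩
    suc k * (H * (suc M C suc k)) + suc k * (suc M C suc k)
      ≡⟨ rearrange′ k H (suc M C suc k) ⟩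
    suc k * (suc H * (suc M C suc k)) ∎
    where
    rearrange : ∀ k H M x y → suc k * (H * x) + (suc M + suc k * H) * y ≡ suc k * (H * (y + x)) + suc M * y
    rearrange = solve-∀
    rearrange′ : ∀ k H x → suc k * (H * x) + suc k * x ≡ suc k * (suc H * x)
    rearrange′ = solve-∀

  -- Walks on heights and the recursion on the first block.

  module _ (a b : ℕ) .{{_ : NonZero (a + b)}} (c : ℕ → ℕ) (m : ℕ) where

    -- This is `a j + b - 1` at `j = i + 1`, arranged so that the predecessor is taken of `a + b`,
    -- which is nonzero.
    rise : ℕ → ℕ
    rise i = a * i + pred (a + b)

    suc-rise : ∀ i → suc (rise i) ≡ a * suc i + b
    suc-rise i = begin
      suc (a * i + pred (a + b)) ≡⟨ +-suc (a * i) (pred (a + b)) ⟨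
      a * i + suc (pred (a + b)) ≡⟨ cong (a * i +_) (suc-pred (a + b)) ⟩
      a * i + (a + b)            ≡⟨ rearrange a b (i) ⟩
      a * suc (i) + b            ∎
      where
      rearrange : ∀ a b i → a * i + (a + b) ≡ a * suc i + b
      rearrange = solve-∀

    -- `H` is the height plus one, so `H = 0` lies below the axis. Once no jump is left the final
    -- descent is forced, hence the value `φ 0`. A jump may raise `H` without bound but lowers `k`,
    -- so the recursion is lexicographic.
    walks : ℕ → ℕ → (ℕ → ℕ) → ℕ
    walks H       zero    φ = φ 0
    walks zero    (suc k) φ = 0
    walks (suc H) (suc k) φ =
      walks H (suc k) φ + sumParts c m λ i → walks (suc (H + rise i)) k (shift (suc i) φ)

    -- One more than the number of blocks: `k` jumps of total index `q` climb `a q + (b - 1) k`, so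
    -- `H - 1 + a q + (b - 1) k` blocks `P_0` must bring the walk down to 0.
    size : ℕ → ℕ → ℕ → ℕ
    size H k q = H + (a * q + b * k)

    private
      W = compositions c m

    -- The factor `suc k` clears the denominator of the closed form. Both `H` and `φ` must be
    -- arbitrary, because a jump raises the height and shifts the test function.
    walks-count : ∀ H k φ →
      suc k * walks H (suc k) φ ≡ W (suc k) (λ q → H * (((size H (suc k) q) ∸ 1) C k) * φ q)
    walks-count zero    k φ = trans (*-zeroʳ (suc k)) (sym (compositions-* c m (suc k) φ 0))
    -- With a single jump nothing is left to choose after it, so the sum over the jump is `W 1 φ` by
    -- definition.
    walks-count (suc H) zero φ = begin
      walks H 1 φ + W 1 φ + 0
        ≡⟨ rearrange (walks H 1 φ) (W 1 φ) ⟩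
      1 * (1 * walks H 1 φ) + 1 * W 1 φ
        ≡⟨ cong (λ x → 1 * x + 1 * W 1 φ) (walks-count H 0 φ) ⟩
      1 * W 1 (λ q → H * 1 * φ q) + 1 * W 1 φ
        ≡⟨ compositions-linear c m 1 (λ q → H * 1 * φ q) φ 1 1 ⟨
      W 1 (λ q → 1 * (H * 1 * φ q) + 1 * φ q)
        ≡⟨ compositions-cong c m 1 (λ q → rearrange′ H (φ q)) ⟩
      W 1 (λ q → suc H * 1 * φ q) ∎
      where
      rearrange : ∀ x y → x + y + 0 ≡ 1 * (1 * x) + 1 * y
      rearrange = solve-∀
      rearrange′ : ∀ H x → 1 * (H * 1 * x) + 1 * x ≡ suc H * 1 * x
      rearrange′ = solve-∀
    -- After a jump `k` jumps remain, so the induction hypothesis there carries the factor `k` and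
    -- not `suc k`. Both sides are therefore multiplied by `k`, which is nonzero here.
    walks-count (suc H) k@(suc k′) φ = *-cancelˡ-≡ _ _ k (begin
      k * (suc k * (walks H (suc k) φ + jumps))
        ≡⟨ rearrange₁ k (walks H (suc k) φ) jumps ⟩
      k * (suc k * walks H (suc k) φ) + suc k * (k * jumps)
        ≡⟨ cong₂ (λ x y → k * x + suc k * y) (walks-count H k φ) jumps-count ⟩
      k * W (suc k) χ + suc k * ((H + b) * W (suc k) ψ + a * firstPart c m k ψ)
        ≡⟨ rearrange₂ k (W (suc k) χ) (H + b) (W (suc k) ψ) a (firstPart c m k ψ) ⟩
      k * W (suc k) χ + 1 * (suc k * (H + b) * W (suc k) ψ + a * (suc k * firstPart c m k ψ))
        -- `suc k` times the first part may be replaced by the total. From here on everything is a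
        -- function of the total `q` alone and can be compared pointwise under `W`.
        ≡⟨ cong (λ x → k * W (suc k) χ + 1 * (suc k * (H + b) * W (suc k) ψ + a * x)) (compositions-weight c m k ψ) ⟨
      k * W (suc k) χ + 1 * (suc k * (H + b) * W (suc k) ψ + a * W (suc k) (λ q → q * ψ q))
        ≡⟨ cong (λ x → k * W (suc k) χ + 1 * x) (compositions-linear c m (suc k) ψ (λ q → q * ψ q) (suc k * (H + b)) a) ⟨
      k * W (suc k) χ + 1 * W (suc k) (λ q → suc k * (H + b) * ψ q + a * (q * ψ q))
        ≡⟨ compositions-linear c m (suc k) χ (λ q → suc k * (H + b) * ψ q + a * (q * ψ q)) k 1 ⟨
      W (suc k) (λ q → k * χ q + 1 * (suc k * (H + b) * ψ q + a * (q * ψ q)))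
        ≡⟨ compositions-cong c m (suc k) pointwise ⟩
      W (suc k) (λ q → k * (suc H * (size H (suc k) q C k) * φ q))
        ≡⟨ compositions-* c m (suc k) (λ q → suc H * (size H (suc k) q C k) * φ q) k ⟩
      k * W (suc k) (λ q → suc H * (size H (suc k) q C k) * φ q) ∎)
      where
      jumps : ℕ
      jumps = sumParts c m λ i → walks (suc (H + rise i)) k (shift (suc i) φ)
      χ ψ : ℕ → ℕ
      χ q = H * ((size H (suc k) q ∸ 1) C k) * φ q
      ψ q = ((size H (suc k) q ∸ 1) C k′) * φ q
      rearrange₁ : ∀ k x y → k * (suc k * (x + y)) ≡ k * (suc k * x) + suc k * (k * y)
      rearrange₁ = solve-∀
      rearrange₂ : ∀ k x h y a z → k * x + suc k * (h * y + a * z) ≡ k * x + 1 * (suc k * h * y + a * (suc k * z))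
      rearrange₂ = solve-∀
      jump-count : ∀ i → k * walks (suc (H + rise i)) k (shift (suc i) φ) ≡
        (H + b) * W k (shift (suc i) ψ) + a * (suc i * W k (shift (suc i) ψ))
      jump-count i = begin
        k * walks (suc (H + rise i)) k (shift (suc i) φ)
          ≡⟨ walks-count (suc (H + rise i)) k′ (shift (suc i) φ) ⟩
        W k (λ q → suc (H + rise i) * ((H + rise i + (a * q + b * k)) C k′) * φ (suc i + q))
          ≡⟨ compositions-cong c m k (λ q → trans (cong₂ (λ x y → x * (y C k′) * φ (suc i + q)) height (cong (_∸ 1) (size-shift q)))
               (*-assoc (H + (a * suc i + b)) _ _)) ⟩
        W k (λ q → (H + (a * suc i + b)) * ψ (suc i + q))
          ≡⟨ compositions-* c m k (shift (suc i) ψ) (H + (a * suc i + b)) ⟩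
        (H + (a * suc i + b)) * W k (shift (suc i) ψ)
          ≡⟨ rearrange H a b (suc i) (W k (shift (suc i) ψ)) ⟩
        (H + b) * W k (shift (suc i) ψ) + a * (suc i * W k (shift (suc i) ψ)) ∎
        where
        height : suc (H + rise i) ≡ H + (a * suc i + b)
        height = trans (sym (+-suc H (rise i))) (cong (H +_) (suc-rise i))
        -- The jump's part moves from the total into the height. The upper index thus agrees with
        -- the one obtained when the first block is `P_0`.
        size-shift : ∀ q → suc (H + rise i) + (a * q + b * k) ≡ size H (suc k) (suc i + q)
        size-shift q = trans (cong (_+ (a * q + b * k)) height) (rearrange′ H a b (suc i) q k)
          where
          rearrange′ : ∀ H a b p q k → H + (a * p + b) + (a * q + b * k) ≡ H + (a * (p + q) + b * suc k)
          rearrange′ = solve-∀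
        rearrange : ∀ H a b p x → (H + (a * p + b)) * x ≡ (H + b) * x + a * (p * x)
        rearrange = solve-∀
      jumps-count : k * jumps ≡ (H + b) * W (suc k) ψ + a * firstPart c m k ψ
      jumps-count = begin
        k * jumps
          ≡⟨ sumParts-* c m _ k ⟨
        sumParts c m (λ i → k * walks (suc (H + rise i)) k (shift (suc i) φ))
          ≡⟨ sumParts-cong c m jump-count ⟩
        sumParts c m (λ i → ((H + b) * W k (shift (suc i) ψ) + a * (suc i * W k (shift (suc i) ψ))))
          ≡⟨ sumParts-linear c m _ _ (H + b) a ⟩
        (H + b) * W (suc k) ψ + a * firstPart c m k ψ ∎
      pointwise : ∀ q → k * χ q + 1 * (suc k * (H + b) * ψ q + a * (q * ψ q)) ≡
        k * (suc H * (size H (suc k) q C k) * φ q)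
      pointwise q = begin
        k * (H * x * φ q) + 1 * (suc k * (H + b) * (y * φ q) + a * (q * (y * φ q)))
          ≡⟨ rearrange k H a b q x y (φ q) ⟩
        (k * (H * x) + (H + (a * q + b * suc k) + k * H) * y) * φ q
          ≡⟨ cong (_* φ q) (binomial-step k′ H (a * q + b * suc k)) ⟩
        k * (suc H * (size H (suc k) q C k)) * φ q
          ≡⟨ *-assoc k (suc H * (size H (suc k) q C k)) (φ q) ⟩
        k * (suc H * (size H (suc k) q C k) * φ q) ∎
        where
        x y : ℕ
        x = (size H (suc k) q ∸ 1) C k
        y = (size H (suc k) q ∸ 1) C k′
        rearrange : ∀ k H a b q x y f → k * (H * x * f) + 1 * (suc k * (H + b) * (y * f) + a * (q * (y * f))) ≡
          (k * (H * x) + (H + (a * q + b * suc k) + k * H) * y) * f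
        rearrange = solve-∀

    -- `H = 1` is height 0, and the upper index `size ∸ 1` becomes `a n + b (k + 1)`.
    walks-from-origin : ∀ n k →
      suc k * walks 1 (suc k) (δ n) ≡ ((a * n + b * suc k) C k) * compositions c m (suc k) (δ n)
    walks-from-origin n k = begin
      suc k * walks 1 (suc k) (δ n)
        ≡⟨ walks-count 1 k (δ n) ⟩
      W (suc k) (λ q → f q * δ n q)
        ≡⟨ compositions-cong c m (suc k) (*-δ f n) ⟩
      W (suc k) (λ q → f n * δ n q)
        ≡⟨ compositions-* c m (suc k) (δ n) (f n) ⟩
      f n * W (suc k) (δ n)
        ≡⟨ cong (_* W (suc k) (δ n)) (*-identityˡ ((a * n + b * suc k) C k)) ⟩
      ((a * n + b * suc k) C k) * W (suc k) (δ n) ∎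
      where
      f : ℕ → ℕ
      f q = 1 * ((a * q + b * suc k) C k)

-- Partial Bell polynomials as counts of coloured compositions.

module PartialBell where

  open Compositions
  open import Data.Nat using (ℕ; zero; suc; NonZero; _!; _≤_; _<_; _∸_; s≤s)
  import Data.Nat as ℕ
  import Data.Nat.Properties as ℕ
  open import Data.Nat.Properties using (_!≢0; _≟_)
  open import Data.Nat.Combinatorics using (_C_)
  import Data.Nat.Tactic.RingSolver as ℕSolver
  import Data.Integer as ℤ
  open import Data.Integer using () renaming (+_ to pos)
  import Data.Integer.Properties as ℤ
  open import Data.Rational using (ℚ; 0ℚ; 1ℚ; _/_; _+_; _*_; fromℚᵘ; +-*-rawSemiring)
  open import Data.Rational.Properties
    using (+-*-commutativeRing; toℚᵘ-fromℚᵘ; toℚᵘ-homo-+; toℚᵘ-homo-*; fromℚᵘ-cong; fromℚᵘ-toℚᵘ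
          ; +-assoc; +-identityˡ; +-identityʳ; *-assoc; *-identityˡ; *-identityʳ; *-zeroˡ; *-zeroʳ; *-distribˡ-+)
  import Data.Rational.Unnormalised as ℚᵘ
  import Data.Rational.Unnormalised.Properties as ℚᵘ
  open import Algebra.Bundles using (CommutativeRing)
  open import Algebra.Definitions.RawSemiring +-*-rawSemiring using (_^_; product; sum)
  open import Algebra.Properties.Semiring.Sum (CommutativeRing.semiring +-*-commutativeRing)
    using () renaming (sum-cong-≗ to ℚ-sum-cong; *-distribˡ-sum to ℚ-*-distribˡ-sum)
  open import Data.Fin using (Fin; zero; suc; toℕ)
  open import Data.Vec as Vec using (Vec; []; _∷_; lookup; tabulate)
  open import Data.List as List using (List; []; _∷_; _++_; _∷ʳ_; foldr; map; upTo; cartesianProductWith; filter)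
  open import Data.List.Properties using (upTo-∷ʳ; map-cong)
  open import Data.Maybe using (nothing)
  open import Data.Product using (_×_; _,_)
  open import Function using (_∘_)
  open import Relation.Nullary using (¬_; Dec; yes; no; contradiction; _×-dec_)
  open import Relation.Binary.PropositionalEquality
  import Tactic.RingSolver.Core.AlmostCommutativeRing as ACR
  open import Tactic.RingSolver using (solve-∀)

  open import Algebra.Properties.Semiring.Sum ℕ.+-*-semiring using () renaming (sum to ∑)
  open ≡-Reasoning

  ℚ-ring : ACR.AlmostCommutativeRing _ _
  ℚ-ring = ACR.fromCommutativeRing +-*-commutativeRing λ _ → nothing

  -- Normalised fractions are blocked by a gcd on open terms. Unnormalised ones add and multiply by
  -- explicit numerators and denominators, so identities are checked there and carried back.
  fromℚᵘ-+ : ∀ p q → fromℚᵘ p + fromℚᵘ q ≡ fromℚᵘ (p ℚᵘ.+ q)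
  fromℚᵘ-+ p q = trans (sym (fromℚᵘ-toℚᵘ _)) (fromℚᵘ-cong (ℚᵘ.≃-trans
    (toℚᵘ-homo-+ (fromℚᵘ p) (fromℚᵘ q)) (ℚᵘ.+-cong (toℚᵘ-fromℚᵘ p) (toℚᵘ-fromℚᵘ q))))

  fromℚᵘ-* : ∀ p q → fromℚᵘ p * fromℚᵘ q ≡ fromℚᵘ (p ℚᵘ.* q)
  fromℚᵘ-* p q = trans (sym (fromℚᵘ-toℚᵘ _)) (fromℚᵘ-cong (ℚᵘ.≃-trans
    (toℚᵘ-homo-* (fromℚᵘ p) (fromℚᵘ q)) (ℚᵘ.*-cong (toℚᵘ-fromℚᵘ p) (toℚᵘ-fromℚᵘ q))))

  fromℕ-+ : ∀ m n → fromℕ (m ℕ.+ n) ≡ fromℕ m + fromℕ n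
  fromℕ-+ m n = trans
    (cong (λ x → fromℚᵘ (ℚᵘ.mkℚᵘ x 0)) (cong₂ ℤ._+_ (sym (ℤ.*-identityʳ (pos m))) (sym (ℤ.*-identityʳ (pos n)))))
    (sym (fromℚᵘ-+ (ℚᵘ.mkℚᵘ (pos m) 0) (ℚᵘ.mkℚᵘ (pos n) 0)))

  fromℕ-* : ∀ m n → fromℕ (m ℕ.* n) ≡ fromℕ m * fromℕ n
  fromℕ-* m n = trans
    (cong (λ x → fromℚᵘ (ℚᵘ.mkℚᵘ x 0)) (ℤ.pos-* m n))
    (sym (fromℚᵘ-* (ℚᵘ.mkℚᵘ (pos m) 0) (ℚᵘ.mkℚᵘ (pos n) 0)))

  /-* : ∀ p q .{{_ : NonZero q}} → (pos p / q) * fromℕ q ≡ fromℕ p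
  /-* p q@(suc q′) = trans (fromℚᵘ-* (ℚᵘ.mkℚᵘ (pos p) q′) (ℚᵘ.mkℚᵘ (pos q) 0))
    (fromℚᵘ-cong {ℚᵘ.mkℚᵘ (pos p) q′ ℚᵘ.* ℚᵘ.mkℚᵘ (pos q) 0} {ℚᵘ.mkℚᵘ (pos p) 0}
      (ℚᵘ.*≡* (trans (ℤ.*-identityʳ (pos p ℤ.* pos q)) (cong (λ x → pos p ℤ.* pos x) (sym (ℕ.*-identityʳ q))))))

  -- Characterises a fraction by its product with the denominator, so that the later identities
  -- never meet a normal form.
  /-unique : ∀ p q .{{_ : NonZero q}} {z} → z * fromℕ q ≡ fromℕ p → z ≡ pos p / q
  /-unique p q {z} zq≡p = begin
    z                           ≡⟨ *-identityʳ z ⟨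
    z * 1ℚ                      ≡⟨ cong (z *_) (/-* 1 q) ⟨
    z * ((pos 1 / q) * fromℕ q)   ≡⟨ rearrange z (pos 1 / q) (fromℕ q) ⟩
    (z * fromℕ q) * (pos 1 / q)   ≡⟨ cong (_* (pos 1 / q)) (trans zq≡p (sym (/-* p q))) ⟩
    ((pos p / q) * fromℕ q) * (pos 1 / q) ≡⟨ rearrange (pos p / q) (pos 1 / q) (fromℕ q) ⟨
    (pos p / q) * ((pos 1 / q) * fromℕ q) ≡⟨ cong ((pos p / q) *_) (/-* 1 q) ⟩
    (pos p / q) * 1ℚ              ≡⟨ *-identityʳ (pos p / q) ⟩
    pos p / q                     ∎
    where
    rearrange : ∀ x y z → x * (y * z) ≡ (x * z) * y
    rearrange = solve-∀ ℚ-ring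

  1/_! : ℕ → ℚ
  1/ n ! = _/_ (pos 1) (n !) {{n !≢0}}

  1/suc! : ∀ n → 1/ suc n ! * fromℕ (suc n) ≡ 1/ n !
  1/suc! n = /-unique 1 (n !) {{n !≢0}} (begin
    1/ suc n ! * fromℕ (suc n) * fromℕ (n !)   ≡⟨ *-assoc (1/ suc n !) (fromℕ (suc n)) (fromℕ (n !)) ⟩
    1/ suc n ! * (fromℕ (suc n) * fromℕ (n !)) ≡⟨ cong (1/ suc n ! *_) (fromℕ-* (suc n) (n !)) ⟨
    1/ suc n ! * fromℕ (suc n !)               ≡⟨ /-* 1 (suc n !) {{suc n !≢0}} ⟩
    1ℚ                                         ∎)

  /-*ˡ : ∀ p q .{{_ : NonZero q}} → pos p / q ≡ fromℕ p * (pos 1 / q)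
  /-*ˡ p q = sym (/-unique p q (begin
    fromℕ p * (pos 1 / q) * fromℕ q   ≡⟨ *-assoc (fromℕ p) (pos 1 / q) (fromℕ q) ⟩
    fromℕ p * ((pos 1 / q) * fromℕ q) ≡⟨ cong (fromℕ p *_) (/-* 1 q) ⟩
    fromℕ p * 1ℚ                    ≡⟨ *-identityʳ (fromℕ p) ⟩
    fromℕ p                         ∎))

  opaque

    -- The series of `exp(x z)` up to degree `N`, with `f i` in place of the power `z^i`.
    expSum : ℕ → ℚ → (ℕ → ℚ) → ℚ
    expSum zero    x f = x ^ 0 * 1/ 0 ! * f 0
    expSum (suc N) x f = expSum N x f + x ^ suc N * 1/ suc N ! * f (suc N)

    expSum-cong : ∀ N x {f g} → (∀ i → f i ≡ g i) → expSum N x f ≡ expSum N x g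
    expSum-cong zero    x f≗g = cong (x ^ 0 * 1/ 0 ! *_) (f≗g 0)
    expSum-cong (suc N) x f≗g = cong₂ (λ y z → y + x ^ suc N * 1/ suc N ! * z) (expSum-cong N x f≗g) (f≗g (suc N))

    expSum-+ : ∀ N x f g → expSum N x (λ i → f i + g i) ≡ expSum N x f + expSum N x g
    expSum-+ zero    x f g = *-distribˡ-+ (x ^ 0 * 1/ 0 !) (f 0) (g 0)
    expSum-+ (suc N) x f g = trans (cong (_+ x ^ suc N * 1/ suc N ! * (f (suc N) + g (suc N))) (expSum-+ N x f g))
      (rearrange (expSum N x f) (expSum N x g) (x ^ suc N * 1/ suc N !) (f (suc N)) (g (suc N)))
      where
      rearrange : ∀ y z e f g → (y + z) + e * (f + g) ≡ (y + e * f) + (z + e * g)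
      rearrange = solve-∀ ℚ-ring

    expSum-* : ∀ N x f y → expSum N x (λ i → y * f i) ≡ y * expSum N x f
    expSum-* zero    x f y = swap (x ^ 0 * 1/ 0 !) y (f 0)
      where
      swap : ∀ x y z → x * (y * z) ≡ y * (x * z)
      swap = solve-∀ ℚ-ring
    expSum-* (suc N) x f y = trans (cong (_+ x ^ suc N * 1/ suc N ! * (y * f (suc N))) (expSum-* N x f y))
      (rearrange (expSum N x f) y (x ^ suc N * 1/ suc N !) (f (suc N)))
      where
      rearrange : ∀ s y e f → y * s + e * (y * f) ≡ y * (s + e * f)
      rearrange = solve-∀ ℚ-ring

    expSum-first : ∀ N x f → (∀ i → f (suc i) ≡ 0ℚ) → expSum N x f ≡ f 0
    expSum-first zero    x f f≡0 = *-identityˡ (f 0)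
    expSum-first (suc N) x f f≡0 = begin
      expSum N x f + x ^ suc N * 1/ suc N ! * f (suc N)
        ≡⟨ cong₂ (λ y z → y + x ^ suc N * 1/ suc N ! * z) (expSum-first N x f f≡0) (f≡0 N) ⟩
      f 0 + x ^ suc N * 1/ suc N ! * 0ℚ
        ≡⟨ cong (f 0 +_) (*-zeroʳ (x ^ suc N * 1/ suc N !)) ⟩
      f 0 + 0ℚ
        ≡⟨ +-identityʳ (f 0) ⟩
      f 0 ∎

    expSum-suc : ∀ N x f → f (suc N) ≡ 0ℚ → expSum (suc N) x f ≡ expSum N x f
    expSum-suc N x f f≡0 = begin
      expSum N x f + x ^ suc N * 1/ suc N ! * f (suc N)
        ≡⟨ cong (λ y → expSum N x f + x ^ suc N * 1/ suc N ! * y) f≡0 ⟩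
      expSum N x f + x ^ suc N * 1/ suc N ! * 0ℚ
        ≡⟨ cong (expSum N x f +_) (*-zeroʳ (x ^ suc N * 1/ suc N !)) ⟩
      expSum N x f + 0ℚ
        ≡⟨ +-identityʳ _ ⟩
      expSum N x f ∎

    -- The operator x d/dx on the exponential series: i x^i / i! is x times x^(i-1) / (i-1)!. The
    -- term `i = 0` disappears, so the cut-off drops from `suc N` to `N`.
    expSum-derivative : ∀ N x f → expSum (suc N) x (λ i → fromℕ i * f i) ≡ x * expSum N x (f ∘ suc)
    expSum-derivative N x f = begin
      expSum N x (λ i → fromℕ i * f i) + x ^ suc N * 1/ suc N ! * (fromℕ (suc N) * f (suc N))
        ≡⟨ cong (λ y → expSum N x (λ i → fromℕ i * f i) + y) top ⟩
      expSum N x (λ i → fromℕ i * f i) + x * (x ^ N * 1/ N ! * f (suc N))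
        ≡⟨ lower N ⟩
      x * expSum N x (f ∘ suc) ∎
      where
      rearrange : ∀ x p s n f → x * p * s * (n * f) ≡ x * (p * (s * n) * f)
      rearrange = solve-∀ ℚ-ring
      top : x ^ suc N * 1/ suc N ! * (fromℕ (suc N) * f (suc N)) ≡ x * (x ^ N * 1/ N ! * f (suc N))
      top = trans (rearrange x (x ^ N) (1/ suc N !) (fromℕ (suc N)) (f (suc N)))
        (cong (λ y → x * (x ^ N * y * f (suc N))) (1/suc! N))
      lower : ∀ N → expSum N x (λ i → fromℕ i * f i) + x * (x ^ N * 1/ N ! * f (suc N)) ≡ x * expSum N x (f ∘ suc)
      lower zero    = trans (cong (_+ x * (1ℚ * 1/ 0 ! * f 1)) (trans (cong (1ℚ * 1/ 0 ! *_) (*-zeroˡ (f 0))) (*-zeroʳ (1ℚ * 1/ 0 !)))) (+-identityˡ _)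
      lower (suc N) = trans (cong (_+ x * (x ^ suc N * 1/ suc N ! * f (suc (suc N)))) (expSum-derivative N x f))
        (sym (*-distribˡ-+ x (expSum N x (f ∘ suc)) _))

  expSum-sum : ∀ N x {m} (y : Fin m → ℚ) (h : Fin m → ℕ → ℚ) →
    expSum N x (λ i → sum (λ j → y j * h j i)) ≡ sum (λ j → y j * expSum N x (h j))
  expSum-sum N x {zero}  y h = trans (expSum-* N x (λ _ → 0ℚ) 0ℚ) (*-zeroˡ (expSum N x (λ _ → 0ℚ)))
  expSum-sum N x {suc m} y h = trans (expSum-+ N x (λ i → y zero * h zero i) (λ i → sum (λ j → y (suc j) * h (suc j) i)))
    (cong₂ _+_ (expSum-* N x (h zero) (y zero)) (expSum-sum N x (y ∘ suc) (h ∘ suc)))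

  module _ (N : ℕ) where

    -- The sum of ∏ xᵢ^αᵢ/αᵢ! φ(Σ αᵢ, Σ gᵢ αᵢ) over all α with entries at most N.
    vecSum : ∀ {m} → (Fin m → ℚ) → (Fin m → ℕ) → (ℕ → ℕ → ℚ) → ℚ
    vecSum {zero}  x g φ = φ 0 0
    vecSum {suc m} x g φ =
      expSum N (x zero) λ i → vecSum (x ∘ suc) (g ∘ suc) λ p q → φ (i ℕ.+ p) (g zero ℕ.* i ℕ.+ q)

    vecSum-cong : ∀ {m} (x : Fin m → ℚ) g {φ ψ : ℕ → ℕ → ℚ} → (∀ p q → φ p q ≡ ψ p q) → vecSum x g φ ≡ vecSum x g ψ
    vecSum-cong {zero}  x g φ≗ψ = φ≗ψ 0 0
    vecSum-cong {suc m} x g φ≗ψ = expSum-cong N (x zero) λ i → vecSum-cong (x ∘ suc) (g ∘ suc) λ p q → φ≗ψ _ _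

    vecSum-+ : ∀ {m} (x : Fin m → ℚ) g (φ ψ : ℕ → ℕ → ℚ) → vecSum x g (λ p q → φ p q + ψ p q) ≡ vecSum x g φ + vecSum x g ψ
    vecSum-+ {zero}  x g φ ψ = refl
    vecSum-+ {suc m} x g φ ψ = trans (expSum-cong N (x zero) λ i → vecSum-+ (x ∘ suc) (g ∘ suc) _ _)
      (expSum-+ N (x zero) _ _)

    vecSum-* : ∀ {m} (x : Fin m → ℚ) g (φ : ℕ → ℕ → ℚ) y → vecSum x g (λ p q → y * φ p q) ≡ y * vecSum x g φ
    vecSum-* {zero}  x g φ y = refl
    vecSum-* {suc m} x g φ y = trans (expSum-cong N (x zero) λ i → vecSum-* (x ∘ suc) (g ∘ suc) _ y)
      (expSum-* N (x zero) _ y)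

    vecSum-zero : ∀ {m} (x : Fin m → ℚ) g (φ : ℕ → ℕ → ℚ) → (∀ p q → φ p q ≡ 0ℚ) → vecSum x g φ ≡ 0ℚ
    vecSum-zero x g φ φ≡0 = begin
      vecSum x g φ                      ≡⟨ vecSum-cong x g (λ p q → trans (φ≡0 p q) (sym (*-zeroˡ (φ p q)))) ⟩
      vecSum x g (λ p q → 0ℚ * φ p q)   ≡⟨ vecSum-* x g φ 0ℚ ⟩
      0ℚ * vecSum x g φ                 ≡⟨ *-zeroˡ (vecSum x g φ) ⟩
      0ℚ                                ∎

    -- Only the zero vector has entry sum 0. This is the start of the induction on the number of
    -- parts.
    vecSum-origin : ∀ {m} (x : Fin m → ℚ) g (φ : ℕ → ℕ → ℚ) → (∀ p q → φ (suc p) q ≡ 0ℚ) → vecSum x g φ ≡ φ 0 0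
    vecSum-origin {zero}  x g φ φ≡0 = refl
    vecSum-origin {suc m} x g φ φ≡0 = begin
      expSum N (x zero) (λ i → vecSum (x ∘ suc) (g ∘ suc) (λ p q → φ (i ℕ.+ p) (g zero ℕ.* i ℕ.+ q)))
        ≡⟨ expSum-first N (x zero) _ (λ i → vecSum-zero (x ∘ suc) (g ∘ suc) _ λ p q → φ≡0 _ _) ⟩
      vecSum (x ∘ suc) (g ∘ suc) (λ p q → φ p (g zero ℕ.* 0 ℕ.+ q))
        ≡⟨ vecSum-origin (x ∘ suc) (g ∘ suc) _ (λ p q → φ≡0 _ _) ⟩
      φ 0 (g zero ℕ.* 0 ℕ.+ 0)
        ≡⟨ cong (φ 0) (trans (ℕ.+-identityʳ _) (ℕ.*-zeroʳ (g zero))) ⟩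
      φ 0 0 ∎

    -- Weighting by |α| is the Euler operator Σ xⱼ ∂/∂xⱼ.
    vecSum-euler : ∀ {m} (x : Fin m → ℚ) g (φ : ℕ → ℕ → ℚ) → (∀ p q → N < p → φ p q ≡ 0ℚ) →
      vecSum x g (λ p q → fromℕ p * φ p q) ≡ sum (λ j → x j * vecSum x g (λ p q → φ (suc p) (g j ℕ.+ q)))
    vecSum-euler {zero}  x g φ φ≡0 = *-zeroˡ (φ 0 0)
    vecSum-euler {suc m} x g φ φ≡0 = begin
      expSum N x₀ (λ i → V (λ p q → fromℕ (i ℕ.+ p) * φᵢ i p q))
        ≡⟨ expSum-cong N x₀ split ⟩
      expSum N x₀ (λ i → fromℕ i * V (φᵢ i) + sum (λ j → x (suc j) * V (λ p q → φᵢ i (suc p) (g (suc j) ℕ.+ q))))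
        ≡⟨ expSum-+ N x₀ _ _ ⟩
      expSum N x₀ (λ i → fromℕ i * V (φᵢ i)) + expSum N x₀ (λ i → sum (λ j → x (suc j) * V (λ p q → φᵢ i (suc p) (g (suc j) ℕ.+ q))))
        ≡⟨ cong₂ _+_ first others ⟩
      x₀ * vecSum x g (λ p q → φ (suc p) (g zero ℕ.+ q)) +
        sum (λ j → x (suc j) * vecSum x g (λ p q → φ (suc p) (g (suc j) ℕ.+ q))) ∎
      where
      x₀ = x zero
      V = vecSum (x ∘ suc) (g ∘ suc)
      φᵢ : ℕ → ℕ → ℕ → ℚ
      φᵢ i p q = φ (i ℕ.+ p) (g zero ℕ.* i ℕ.+ q)
      -- The entry sum is the first entry plus the rest: the former will give the derivative in
      -- `x₀`, the latter is the induction hypothesis.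
      split : ∀ i → V (λ p q → fromℕ (i ℕ.+ p) * φᵢ i p q) ≡
        fromℕ i * V (φᵢ i) + sum (λ j → x (suc j) * V (λ p q → φᵢ i (suc p) (g (suc j) ℕ.+ q)))
      split i = begin
        V (λ p q → fromℕ (i ℕ.+ p) * φᵢ i p q)
          ≡⟨ vecSum-cong (x ∘ suc) (g ∘ suc) (λ p q → trans (cong (_* φᵢ i p q) (fromℕ-+ i p)) (rearrange (fromℕ i) (fromℕ p) (φᵢ i p q))) ⟩
        V (λ p q → fromℕ i * φᵢ i p q + fromℕ p * φᵢ i p q)
          ≡⟨ vecSum-+ (x ∘ suc) (g ∘ suc) _ _ ⟩
        V (λ p q → fromℕ i * φᵢ i p q) + V (λ p q → fromℕ p * φᵢ i p q)
          ≡⟨ cong₂ _+_ (vecSum-* (x ∘ suc) (g ∘ suc) (φᵢ i) (fromℕ i))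
               (vecSum-euler (x ∘ suc) (g ∘ suc) (φᵢ i) λ p q N<p → φ≡0 _ _ (ℕ.m≤n⇒m≤o+n i N<p)) ⟩
        fromℕ i * V (φᵢ i) + sum (λ j → x (suc j) * V (λ p q → φᵢ i (suc p) (g (suc j) ℕ.+ q))) ∎
        where
        rearrange : ∀ x y z → (x + y) * z ≡ x * z + y * z
        rearrange = solve-∀ ℚ-ring
      -- The derivative needs the cut-off `suc N`. The term to be added has entry sum above `N`,
      -- where `φ` vanishes.
      last≡0 : fromℕ (suc N) * V (φᵢ (suc N)) ≡ 0ℚ
      last≡0 = trans (cong (fromℕ (suc N) *_)
        (vecSum-zero (x ∘ suc) (g ∘ suc) (φᵢ (suc N)) λ p q → φ≡0 _ _ (s≤s (ℕ.m≤m+n N p)))) (*-zeroʳ (fromℕ (suc N)))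
      first : expSum N x₀ (λ i → fromℕ i * V (φᵢ i)) ≡ x₀ * vecSum x g (λ p q → φ (suc p) (g zero ℕ.+ q))
      first = begin
        expSum N x₀ (λ i → fromℕ i * V (φᵢ i))       ≡⟨ expSum-suc N x₀ _ last≡0 ⟨
        expSum (suc N) x₀ (λ i → fromℕ i * V (φᵢ i)) ≡⟨ expSum-derivative N x₀ (λ i → V (φᵢ i)) ⟩
        x₀ * expSum N x₀ (λ i → V (φᵢ (suc i)))
          ≡⟨ cong (x₀ *_) (expSum-cong N x₀ λ i → vecSum-cong (x ∘ suc) (g ∘ suc) λ p q →
               cong (φ (suc (i ℕ.+ p))) (rearrange (g zero) i q)) ⟩
        x₀ * vecSum x g (λ p q → φ (suc p) (g zero ℕ.+ q)) ∎
        where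
        rearrange : ∀ g i q → g ℕ.* suc i ℕ.+ q ≡ g ℕ.+ (g ℕ.* i ℕ.+ q)
        rearrange = ℕSolver.solve-∀
      others : expSum N x₀ (λ i → sum (λ j → x (suc j) * V (λ p q → φᵢ i (suc p) (g (suc j) ℕ.+ q)))) ≡
        sum (λ j → x (suc j) * vecSum x g (λ p q → φ (suc p) (g (suc j) ℕ.+ q)))
      others = trans (expSum-sum N x₀ (x ∘ suc) (λ j i → V (λ p q → φᵢ i (suc p) (g (suc j) ℕ.+ q))))
        (ℚ-sum-cong {m} λ j → cong (x (suc j) *_) (expSum-cong N x₀ λ i → vecSum-cong (x ∘ suc) (g ∘ suc) λ p q →
          cong₂ φ (ℕ.+-suc i p) (rearrange (g zero ℕ.* i) (g (suc j)) q)))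
        where
        rearrange : ∀ x y z → x ℕ.+ (y ℕ.+ z) ≡ y ℕ.+ (x ℕ.+ z)
        rearrange = ℕSolver.solve-∀

  fromℕ-∑ : ∀ {m} (f : Fin m → ℕ) → fromℕ (∑ f) ≡ sum (fromℕ ∘ f)
  fromℕ-∑ {zero}  f = refl
  fromℕ-∑ {suc m} f = trans (fromℕ-+ (f zero) (∑ (f ∘ suc))) (cong (fromℕ (f zero) +_) (fromℕ-∑ (f ∘ suc)))

  opaque
    unfolding sumParts

    fromℕ-sumParts : ∀ c m f → fromℕ (sumParts c m f) ≡ sum {m} (λ j → fromℕ (c (suc (toℕ j))) * fromℕ (f (toℕ j)))
    fromℕ-sumParts c m f = trans (fromℕ-∑ {m} _)
      (ℚ-sum-cong {m} λ j → fromℕ-* (c (suc (toℕ j))) (f (toℕ j)))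

  module _ (N : ℕ) (c : ℕ → ℕ) {m} (x : Fin m → ℚ) (x≡c : ∀ j → x j ≡ fromℕ (c (suc (toℕ j)))) where

    private
      g : Fin m → ℕ
      g j = suc (toℕ j)

    -- Euler's identity at degree `suc k` splits off one variable `x j` and moves `φ` by the part
    -- `g j`, which is the recursion of `compositions` on the first part; the factor `suc k` it
    -- produces is absorbed by the factorial. The bound `k ≤ N` ensures that the cut-off loses no
    -- vector of entry sum `k`.
    vecSum-compositions : ∀ k φ → k ≤ N →
      fromℕ (k !) * vecSum N x g (λ p q → fromℕ (δ k p) * fromℕ (φ q)) ≡ fromℕ (compositions c m k φ)
    vecSum-compositions zero    φ _ = begin
      1ℚ * vecSum N x g (λ p q → fromℕ (δ 0 p) * fromℕ (φ q)) ≡⟨ *-identityˡ _ ⟩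
      vecSum N x g (λ p q → fromℕ (δ 0 p) * fromℕ (φ q))      ≡⟨ vecSum-origin N x g _ (λ p q → *-zeroˡ (fromℕ (φ q))) ⟩
      1ℚ * fromℕ (φ 0)                                        ≡⟨ *-identityˡ (fromℕ (φ 0)) ⟩
      fromℕ (φ 0)                                             ∎
    vecSum-compositions (suc k) φ k<N = begin
      fromℕ (suc k !) * vecSum N x g ψ
        ≡⟨ cong (_* vecSum N x g ψ) (fromℕ-* (suc k) (k !)) ⟩
      fromℕ (suc k) * fromℕ (k !) * vecSum N x g ψ
        ≡⟨ rearrange (fromℕ (suc k)) (fromℕ (k !)) (vecSum N x g ψ) ⟩
      fromℕ (k !) * (fromℕ (suc k) * vecSum N x g ψ)
        ≡⟨ cong (fromℕ (k !) *_) (vecSum-* N x g ψ (fromℕ (suc k))) ⟨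
      fromℕ (k !) * vecSum N x g (λ p q → fromℕ (suc k) * ψ p q)
        -- `ψ` lives at entry sum `suc k`, so the constant `suc k` may be read as the weight `p`
        -- that Euler's identity requires.
        ≡⟨ cong (fromℕ (k !) *_) (vecSum-cong N x g concentrated) ⟩
      fromℕ (k !) * vecSum N x g (λ p q → fromℕ p * ψ p q)
        ≡⟨ cong (fromℕ (k !) *_) (vecSum-euler N x g ψ λ p q N<p →
             trans (cong (λ y → fromℕ y * fromℕ (φ q)) (δ-≢ (ℕ.<⇒≢ (ℕ.≤-<-trans k<N N<p)))) (*-zeroˡ (fromℕ (φ q)))) ⟩
      fromℕ (k !) * sum (λ j → x j * vecSum N x g (λ p q → fromℕ (δ k p) * fromℕ (φ (g j ℕ.+ q))))
        ≡⟨ ℚ-*-distribˡ-sum {m} (fromℕ (k !)) _ ⟩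
      sum (λ j → fromℕ (k !) * (x j * vecSum N x g (λ p q → fromℕ (δ k p) * fromℕ (φ (g j ℕ.+ q)))))
        ≡⟨ ℚ-sum-cong {m} (λ j → trans (swap (fromℕ (k !)) (x j) _)
             (cong₂ _*_ (x≡c j) (vecSum-compositions k (shift (g j) φ) (ℕ.<⇒≤ k<N)))) ⟩
      sum (λ j → fromℕ (c (g j)) * fromℕ (compositions c m k (shift (g j) φ)))
        ≡⟨ fromℕ-sumParts c m _ ⟨
      fromℕ (compositions c m (suc k) φ) ∎
      where
      ψ : ℕ → ℕ → ℚ
      ψ p q = fromℕ (δ (suc k) p) * fromℕ (φ q)
      rearrange : ∀ x y z → x * y * z ≡ y * (x * z)
      rearrange = solve-∀ ℚ-ring
      swap : ∀ x y z → x * (y * z) ≡ y * (x * z)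
      swap = solve-∀ ℚ-ring
      concentrated : ∀ p q → fromℕ (suc k) * ψ p q ≡ fromℕ p * ψ p q
      concentrated p q = begin
        fromℕ (suc k) * (fromℕ (δ (suc k) p) * fromℕ (φ q))
          ≡⟨ *-assoc (fromℕ (suc k)) (fromℕ (δ (suc k) p)) (fromℕ (φ q)) ⟨
        fromℕ (suc k) * fromℕ (δ (suc k) p) * fromℕ (φ q)
          ≡⟨ cong (_* fromℕ (φ q)) (trans (sym (fromℕ-* (suc k) (δ (suc k) p)))
               (trans (cong fromℕ (sym (*-δ (λ p → p) (suc k) p))) (fromℕ-* p (δ (suc k) p)))) ⟩
        fromℕ p * fromℕ (δ (suc k) p) * fromℕ (φ q)
          ≡⟨ *-assoc (fromℕ p) (fromℕ (δ (suc k) p)) (fromℕ (φ q)) ⟩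
        fromℕ p * (fromℕ (δ (suc k) p) * fromℕ (φ q)) ∎

  -- From the finite search defining `Bell` to nested exponential sums.

  listSum : {A : Set} → (A → ℚ) → List A → ℚ
  listSum f = foldr _+_ 0ℚ ∘ map f

  listSum-++ : ∀ {A : Set} (f : A → ℚ) xs ys → listSum f (xs ++ ys) ≡ listSum f xs + listSum f ys
  listSum-++ f []       ys = sym (+-identityˡ _)
  listSum-++ f (x ∷ xs) ys = trans (cong (f x +_) (listSum-++ f xs ys)) (sym (+-assoc (f x) (listSum f xs) (listSum f ys)))

  listSum-map : ∀ {A B : Set} (f : B → ℚ) (h : A → B) xs → listSum f (map h xs) ≡ listSum (f ∘ h) xs
  listSum-map f h []       = refl
  listSum-map f h (x ∷ xs) = cong (f (h x) +_) (listSum-map f h xs)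

  listSum-cong : ∀ {A : Set} {f g : A → ℚ} → (∀ x → f x ≡ g x) → ∀ xs → listSum f xs ≡ listSum g xs
  listSum-cong f≗g xs = cong (foldr _+_ 0ℚ) (map-cong f≗g xs)

  listSum-* : ∀ {A : Set} y (f : A → ℚ) xs → listSum (λ x → y * f x) xs ≡ y * listSum f xs
  listSum-* y f []       = sym (*-zeroʳ y)
  listSum-* y f (x ∷ xs) = trans (cong (y * f x +_) (listSum-* y f xs)) (sym (*-distribˡ-+ y (f x) (listSum f xs)))

  -- Trades the decidable test for a summand that vanishes outside it, so that `δ` can take over the
  -- role of the constraint.
  listSum-filter : {A : Set} {P : A → Set} (P? : ∀ x → Dec (P x)) (f g : A → ℚ) →
    (∀ x → P x → f x ≡ g x) → (∀ x → ¬ P x → g x ≡ 0ℚ) → ∀ xs → listSum f (filter P? xs) ≡ listSum g xs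
  listSum-filter P? f g yes-eq no-eq []       = refl
  listSum-filter P? f g yes-eq no-eq (x ∷ xs) with P? x
  ... | yes px = cong₂ _+_ (yes-eq x px) (listSum-filter P? f g yes-eq no-eq xs)
  ... | no ¬px = trans (listSum-filter P? f g yes-eq no-eq xs)
    (sym (trans (cong (_+ listSum g xs) (no-eq x ¬px)) (+-identityˡ _)))

  listSum-cartesianProductWith : ∀ {A B D : Set} (f : D → ℚ) (h : A → B → D) xs ys →
    listSum f (cartesianProductWith h xs ys) ≡ listSum (λ x → listSum (λ y → f (h x y)) ys) xs
  listSum-cartesianProductWith f h []       ys = refl
  listSum-cartesianProductWith f h (x ∷ xs) ys = trans (listSum-++ f (map (h x) ys) _)
    (cong₂ _+_ (listSum-map f (h x) ys) (listSum-cartesianProductWith f h xs ys))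

  opaque
    unfolding expSum

    listSum-upTo : ∀ N x f → listSum (λ i → x ^ i * 1/ i ! * f i) (upTo (suc N)) ≡ expSum N x f
    listSum-upTo zero    x f = +-identityʳ _
    listSum-upTo (suc N) x f = begin
      listSum h (upTo (suc (suc N)))               ≡⟨ cong (listSum h) (upTo-∷ʳ (suc N)) ⟨
      listSum h (upTo (suc N) ∷ʳ suc N)            ≡⟨ listSum-++ h (upTo (suc N)) (suc N ∷ []) ⟩
      listSum h (upTo (suc N)) + (h (suc N) + 0ℚ)  ≡⟨ cong₂ _+_ (listSum-upTo N x f) (+-identityʳ (h (suc N))) ⟩
      expSum (suc N) x f                           ∎
      where
      h : ℕ → ℚ
      h i = x ^ i * 1/ i ! * f i

  monomial : ∀ {m} → (Fin m → ℚ) → Vec ℕ m → ℚ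
  monomial x α = _/_ (pos 1) (∏! α) {{∏!≢0 α}} * product (λ i → x i ^ lookup α i)

  weightBy : ∀ {m} → (Fin m → ℕ) → Vec ℕ m → ℕ
  weightBy g α = Vec.sum (tabulate λ i → g i ℕ.* lookup α i)

  monomial-∷ : ∀ {m} (x : Fin (suc m) → ℚ) i α →
    monomial x (i ∷ α) ≡ x zero ^ i * 1/ i ! * monomial (x ∘ suc) α
  monomial-∷ x i α = trans (cong (_* (x zero ^ i * product (λ j → x (suc j) ^ lookup α j))) (sym split))
    (rearrange (1/ i !) (_/_ (pos 1) (∏! α) {{∏!≢0 α}}) (x zero ^ i) (product (λ j → x (suc j) ^ lookup α j)))
    where
    rearrange : ∀ e p y z → (e * p) * (y * z) ≡ y * e * (p * z)
    rearrange = solve-∀ ℚ-ring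
    rearrange′ : ∀ e p y z → (e * p) * (y * z) ≡ (e * y) * (p * z)
    rearrange′ = solve-∀ ℚ-ring
    split : 1/ i ! * (_/_ (pos 1) (∏! α) {{∏!≢0 α}}) ≡ _/_ (pos 1) (∏! (i ∷ α)) {{∏!≢0 (i ∷ α)}}
    split = /-unique 1 (∏! (i ∷ α)) {{∏!≢0 (i ∷ α)}} (begin
      1/ i ! * 1/∏ * fromℕ (i ! ℕ.* ∏! α)          ≡⟨ cong (1/ i ! * 1/∏ *_) (fromℕ-* (i !) (∏! α)) ⟩
      1/ i ! * 1/∏ * (fromℕ (i !) * fromℕ (∏! α))  ≡⟨ rearrange′ (1/ i !) 1/∏ (fromℕ (i !)) (fromℕ (∏! α)) ⟩
      1/ i ! * fromℕ (i !) * (1/∏ * fromℕ (∏! α))  ≡⟨ cong₂ _*_ (/-* 1 (i !) {{i !≢0}}) (/-* 1 (∏! α) {{∏!≢0 α}}) ⟩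
      1ℚ ∎)
      where
      1/∏ : ℚ
      1/∏ = _/_ (pos 1) (∏! α) {{∏!≢0 α}}

  -- The box is a cartesian product of the ranges `0, …, N` and the monomial factors along it, so
  -- the sum nests coordinate by coordinate.
  listSum-boundedVecs : ∀ N {m} (x : Fin m → ℚ) g φ →
    listSum (λ α → monomial x α * φ (Vec.sum α) (weightBy g α)) (boundedVecs N m) ≡ vecSum N x g φ
  listSum-boundedVecs N {zero}  x g φ = trans (+-identityʳ _) (*-identityˡ (φ 0 0))
  listSum-boundedVecs N {suc m} x g φ = begin
    listSum F (cartesianProductWith _∷_ (upTo (suc N)) (boundedVecs N m))
      ≡⟨ listSum-cartesianProductWith F _∷_ (upTo (suc N)) (boundedVecs N m) ⟩
    listSum (λ i → listSum (λ α → F (i ∷ α)) (boundedVecs N m)) (upTo (suc N))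
      ≡⟨ listSum-cong (λ i → trans (listSum-cong (split i) (boundedVecs N m)) (listSum-* (x zero ^ i * 1/ i !) (G i) (boundedVecs N m))) (upTo (suc N)) ⟩
    listSum (λ i → x zero ^ i * 1/ i ! * listSum (G i) (boundedVecs N m)) (upTo (suc N))
      ≡⟨ listSum-cong (λ i → cong (x zero ^ i * 1/ i ! *_) (listSum-boundedVecs N (x ∘ suc) (g ∘ suc) (φᵢ i))) (upTo (suc N)) ⟩
    listSum (λ i → x zero ^ i * 1/ i ! * vecSum N (x ∘ suc) (g ∘ suc) (φᵢ i)) (upTo (suc N))
      ≡⟨ listSum-upTo N (x zero) (λ i → vecSum N (x ∘ suc) (g ∘ suc) (φᵢ i)) ⟩
    vecSum N x g φ ∎
    where
    F : Vec ℕ (suc m) → ℚ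
    F α = monomial x α * φ (Vec.sum α) (weightBy g α)
    φᵢ : ℕ → ℕ → ℕ → ℚ
    φᵢ i p q = φ (i ℕ.+ p) (g zero ℕ.* i ℕ.+ q)
    G : ℕ → Vec ℕ m → ℚ
    G i α = monomial (x ∘ suc) α * φᵢ i (Vec.sum α) (weightBy (g ∘ suc) α)
    split : ∀ i α → F (i ∷ α) ≡ x zero ^ i * 1/ i ! * G i α
    split i α = trans (cong (_* φᵢ i (Vec.sum α) (weightBy (g ∘ suc) α)) (monomial-∷ x i α))
      (*-assoc (x zero ^ i * 1/ i !) (monomial (x ∘ suc) α) (φᵢ i (Vec.sum α) (weightBy (g ∘ suc) α)))

  module _ (c : ℕ → ℕ) where

    private
      x : ∀ {m} → Fin m → ℚ
      x j = fromℕ (suc (toℕ j) ! ℕ.* c (suc (toℕ j))) * 1/ suc (toℕ j) !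

    -- Both conditions defining `π n k` become factors `δ`, and the search bound `k` on the entries
    -- becomes the cut-off of the exponential series.
    Bell-vecSum : ∀ n k → Bell n k (λ j → fromℕ (j ! ℕ.* c j)) ≡
      fromℕ (n !) * vecSum k {suc (n ∸ k)} x (λ j → suc (toℕ j)) (λ p q → fromℕ (δ k p) * fromℕ (δ n q))
    Bell-vecSum n k = begin
      listSum (bellTerm n y) (π n k)
        ≡⟨ listSum-filter (λ α → (Vec.sum α ≟ k) ×-dec (weight α ≟ n)) (bellTerm n y) G inside outside (boundedVecs k (suc (n ∸ k))) ⟩
      listSum G (boundedVecs k (suc (n ∸ k)))
        ≡⟨ listSum-* (fromℕ (n !)) (λ α → monomial x α * Δ (Vec.sum α) (weight α)) (boundedVecs k (suc (n ∸ k))) ⟩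
      fromℕ (n !) * listSum (λ α → monomial x α * Δ (Vec.sum α) (weight α)) (boundedVecs k (suc (n ∸ k)))
        ≡⟨ cong (fromℕ (n !) *_) (listSum-boundedVecs k {suc (n ∸ k)} x (λ j → suc (toℕ j)) Δ) ⟩
      fromℕ (n !) * vecSum k {suc (n ∸ k)} x (λ j → suc (toℕ j)) Δ ∎
      where
      y : ℕ → ℚ
      y j = fromℕ (j ! ℕ.* c j)
      Δ : ℕ → ℕ → ℚ
      Δ p q = fromℕ (δ k p) * fromℕ (δ n q)
      G : Vec ℕ (suc (n ∸ k)) → ℚ
      G α = fromℕ (n !) * (monomial x α * Δ (Vec.sum α) (weight α))
      inside : ∀ α → Vec.sum α ≡ k × weight α ≡ n → bellTerm n y α ≡ G α
      inside α (p , q) = begin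
        _/_ (pos (n !)) (∏! α) {{∏!≢0 α}} * X
          ≡⟨ cong (_* X) (/-*ˡ (n !) (∏! α) {{∏!≢0 α}}) ⟩
        fromℕ (n !) * _/_ (pos 1) (∏! α) {{∏!≢0 α}} * X
          ≡⟨ *-assoc (fromℕ (n !)) (_/_ (pos 1) (∏! α) {{∏!≢0 α}}) X ⟩
        fromℕ (n !) * monomial x α
          ≡⟨ cong (fromℕ (n !) *_) (*-identityʳ (monomial x α)) ⟨
        fromℕ (n !) * (monomial x α * 1ℚ)
          ≡⟨ cong (λ z → fromℕ (n !) * (monomial x α * z)) (cong₂ (λ s t → fromℕ s * fromℕ t) (δ-refl k) (δ-refl n)) ⟨
        fromℕ (n !) * (monomial x α * Δ k n)
          ≡⟨ cong (λ z → fromℕ (n !) * (monomial x α * z)) (cong₂ Δ p q) ⟨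
        G α ∎
        where
        X : ℚ
        X = product (λ i → x i ^ lookup α i)
      outside : ∀ α → ¬ (Vec.sum α ≡ k × weight α ≡ n) → G α ≡ 0ℚ
      outside α ¬p = trans (cong (λ z → fromℕ (n !) * (monomial x α * z)) Δ≡0)
        (trans (cong (fromℕ (n !) *_) (*-zeroʳ (monomial x α))) (*-zeroʳ (fromℕ (n !))))
        where
        Δ≡0 : Δ (Vec.sum α) (weight α) ≡ 0ℚ
        Δ≡0 with k ≟ Vec.sum α | n ≟ weight α
        ... | no k≢ | _ = trans (cong (λ z → fromℕ z * fromℕ (δ n (weight α))) (δ-≢ k≢)) (*-zeroˡ (fromℕ (δ n (weight α))))
        ... | yes _ | no n≢ = trans (cong (λ z → fromℕ (δ k (Vec.sum α)) * fromℕ z) (δ-≢ n≢)) (*-zeroʳ (fromℕ (δ k (Vec.sum α))))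
        ... | yes p | yes q = contradiction (sym p , sym q) ¬p

    Bell-compositions : ∀ n k → k ≤ n → 1 ≤ k → fromℕ (k !) * Bell n k (λ j → fromℕ (j ! ℕ.* c j)) ≡
      fromℕ (n !) * fromℕ (compositions c n k (δ n))
    Bell-compositions n k k≤n 1≤k = begin
      fromℕ (k !) * Bell n k (λ j → fromℕ (j ! ℕ.* c j))
        ≡⟨ cong (fromℕ (k !) *_) (Bell-vecSum n k) ⟩
      fromℕ (k !) * (fromℕ (n !) * V)
        ≡⟨ swap (fromℕ (k !)) (fromℕ (n !)) V ⟩
      fromℕ (n !) * (fromℕ (k !) * V)
        ≡⟨ cong (fromℕ (n !) *_) (vecSum-compositions k c {suc (n ∸ k)} x x≡c k (δ n) ℕ.≤-refl) ⟩
      fromℕ (n !) * fromℕ (compositions c (suc (n ∸ k)) k (δ n))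
        -- The polynomial has `n ∸ k + 1` arguments, while walks admit parts up to `n`. Totals from
        -- `(n ∸ k + 1) + k = n + 1` on are killed by `δ n`.
        ≡⟨ cong (λ z → fromℕ (n !) * fromℕ z) (compositions-truncate c k (δ n) (ℕ.∸-monoʳ-< 1≤k k≤n)
             λ q n<q → δ-≢ (ℕ.<⇒≢ (subst (_≤ q) (cong suc (ℕ.m∸n+n≡m k≤n)) n<q))) ⟨
      fromℕ (n !) * fromℕ (compositions c n k (δ n)) ∎
      where
      V : ℚ
      V = vecSum k {suc (n ∸ k)} x (λ j → suc (toℕ j)) (λ p q → fromℕ (δ k p) * fromℕ (δ n q))
      swap : ∀ x y z → x * (y * z) ≡ y * (x * z)
      swap = solve-∀ ℚ-ring
      x≡c : ∀ {m} (j : Fin m) → x j ≡ fromℕ (c (suc (toℕ j)))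
      x≡c j = begin
        fromℕ (i ! ℕ.* c i) * 1/ i !          ≡⟨ cong (_* 1/ i !) (fromℕ-* (i !) (c i)) ⟩
        fromℕ (i !) * fromℕ (c i) * 1/ i !    ≡⟨ rearrange (fromℕ (i !)) (fromℕ (c i)) (1/ i !) ⟩
        1/ i ! * fromℕ (i !) * fromℕ (c i)    ≡⟨ cong (_* fromℕ (c i)) (/-* 1 (i !) {{i !≢0}}) ⟩
        1ℚ * fromℕ (c i)                      ≡⟨ *-identityˡ (fromℕ (c i)) ⟩
        fromℕ (c i)                           ∎
        where
        i = suc (toℕ j)
        rearrange : ∀ x y z → x * y * z ≡ z * x * y
        rearrange = solve-∀ ℚ-ring

    -- Since `k ! = k * (k - 1) !`, the identity for `Bell` supplies a factor `k` that cancels the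
    -- one in front of `walks`; what stays is the `(k - 1) !` of the summand.
    summand-walks : ∀ a b .{{_ : NonZero (a ℕ.+ b)}} n k → 1 ≤ k → k ≤ n →
      fromℕ (walks a b c n 1 k (δ n)) ≡ summand a b c n k
    summand-walks a b n k@(suc k′) 1≤k k≤n = begin
      w                                                 ≡⟨ cancel-k w ⟨
      (pos 1 / k) * (fromℕ k * w)                         ≡⟨ cong ((pos 1 / k) *_) (fromℕ-* k (walks a b c n 1 k (δ n))) ⟨
      (pos 1 / k) * fromℕ (k ℕ.* walks a b c n 1 k (δ n)) ≡⟨ cong (λ z → (pos 1 / k) * fromℕ z) (walks-from-origin a b c n n k′) ⟩
      (pos 1 / k) * fromℕ (B ℕ.* compositions c n k (δ n)) ≡⟨ cong ((pos 1 / k) *_) (fromℕ-* B (compositions c n k (δ n))) ⟩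
      (pos 1 / k) * (fromℕ B * W)                         ≡⟨ cong (λ z → (pos 1 / k) * (fromℕ B * z)) W≡ ⟩
      (pos 1 / k) * (fromℕ B * (1/ n ! * (fromℕ k * fromℕ (k′ !) * bell)))
        ≡⟨ rearrange₁ (pos 1 / k) (fromℕ B) (1/ n !) (fromℕ k) (fromℕ (k′ !)) bell ⟩
      (pos 1 / k) * (fromℕ k * (fromℕ B * (fromℕ (k′ !) * 1/ n !) * bell))
        ≡⟨ cancel-k _ ⟩
      fromℕ B * (fromℕ (k′ !) * 1/ n !) * bell
        ≡⟨ cong (λ z → fromℕ B * z * bell) (/-*ˡ (k′ !) (n !) {{n !≢0}}) ⟨
      summand a b c n k ∎
      where
      B : ℕ
      B = (a ℕ.* n ℕ.+ b ℕ.* k) C k′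
      w W bell : ℚ
      w = fromℕ (walks a b c n 1 k (δ n))
      W = fromℕ (compositions c n k (δ n))
      bell = Bell n k (λ j → fromℕ (j ! ℕ.* c j))
      rearrange₁ : ∀ r b s k f l → r * (b * (s * (k * f * l))) ≡ r * (k * (b * (f * s) * l))
      rearrange₁ = solve-∀ ℚ-ring
      cancel-k : ∀ z → (pos 1 / k) * (fromℕ k * z) ≡ z
      cancel-k z = trans (sym (*-assoc (pos 1 / k) (fromℕ k) z)) (trans (cong (_* z) (/-* 1 k)) (*-identityˡ z))
      W≡ : W ≡ 1/ n ! * (fromℕ k * fromℕ (k′ !) * bell)
      W≡ = begin
        W                                       ≡⟨ *-identityˡ W ⟨
        1ℚ * W                                  ≡⟨ cong (_* W) (/-* 1 (n !) {{n !≢0}}) ⟨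
        1/ n ! * fromℕ (n !) * W                ≡⟨ *-assoc (1/ n !) (fromℕ (n !)) W ⟩
        1/ n ! * (fromℕ (n !) * W)              ≡⟨ cong (1/ n ! *_) (Bell-compositions n k k≤n 1≤k) ⟨
        1/ n ! * (fromℕ (k !) * bell)           ≡⟨ cong (λ z → 1/ n ! * (z * bell)) (fromℕ-* k (k′ !)) ⟩
        1/ n ! * (fromℕ k * fromℕ (k′ !) * bell) ∎

-- The bijection between walks and coloured Dyck words.

module WalksAndWords where

  open Compositions
  open PartialBell
  open import Data.Nat using (ℕ; zero; suc; pred; _+_; _*_; _≤_; _<_; z≤n; s≤s; NonZero) renaming (_/_ to _div_)
  open import Data.Nat.Properties
  open import Data.Nat.DivMod using (m*n/n≡m)
  open import Data.Nat.Tactic.RingSolver using (solve-∀)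
  open import Algebra.Properties.Semiring.Sum +-*-semiring using () renaming (sum to ∑)
  open import Data.Empty using (⊥)
  open import Data.Fin as Fin using (Fin; zero; suc; toℕ; fromℕ<)
  open import Data.Fin.Properties using (+↔⊎; *↔×; 0↔⊥; toℕ-injective; toℕ-fromℕ<; toℕ-cast)
  open import Data.List using (List; []; _∷_; _++_; replicate; concatMap; length; filter; map)
  open import Data.List.Properties using (∷-injectiveˡ; ∷-injectiveʳ; ++-assoc; ++-cancelˡ; filter-++; length-++)
  open import Data.List.Relation.Unary.All as All using (All; []; _∷_)
  open import Data.Product using (Σ; Σ-syntax; ∃-syntax; _×_; _,_; proj₁; proj₂)
  open import Data.Product.Function.NonDependent.Propositional using (_×-↔_)
  open import Data.Sum using (_⊎_; inj₁; inj₂)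
  open import Data.Sum.Function.Propositional using (_⊎-↔_)
  open import Function using (_∘_; _↔_; mk↔ₛ′; Inverse)
  open import Function.Construct.Composition using (_↔-∘_)
  open import Function.Construct.Identity using (↔-id)
  open import Level using (0ℓ)
  open import Relation.Binary using (Setoid)
  open import Relation.Nullary using (contradiction)
  open import Relation.Binary.PropositionalEquality
  open ≡-Reasoning

  ∑-↔ : ∀ {m} {f : Fin m → ℕ} {B : Fin m → Set} → (∀ j → Fin (f j) ↔ B j) → Fin (∑ f) ↔ Σ (Fin m) B
  ∑-↔ {zero}      f↔B = mk↔ₛ′ (λ ()) (λ ()) (λ ()) (λ ())
  ∑-↔ {suc m} {B = B} f↔B = Σ-suc ↔-∘ ((f↔B zero ⊎-↔ ∑-↔ (f↔B ∘ suc)) ↔-∘ +↔⊎)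
    where
    to : B zero ⊎ Σ (Fin m) (B ∘ suc) → Σ (Fin (suc m)) B
    to (inj₁ x)       = zero , x
    to (inj₂ (j , x)) = suc j , x
    from : Σ (Fin (suc m)) B → B zero ⊎ Σ (Fin m) (B ∘ suc)
    from (zero , x)  = inj₁ x
    from (suc j , x) = inj₂ (j , x)
    Σ-suc : (B zero ⊎ Σ (Fin m) (B ∘ suc)) ↔ Σ (Fin (suc m)) B
    Σ-suc = mk↔ₛ′ to from (λ { (zero , x) → refl ; (suc j , x) → refl }) (λ { (inj₁ x) → refl ; (inj₂ x) → refl })

  -- Equality on ℕ has at most one proof, so `δ n q` counts the proofs of `q ≡ n`. A walk can thus
  -- carry the evidence that its indices add up to `n`.
  δ-↔ : ∀ n q → Fin (δ n q) ↔ (q ≡ n)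
  δ-↔ zero    zero    = mk↔ₛ′ (λ _ → refl) (λ _ → zero) (λ p → ≡-irrelevant _ p) (λ { zero → refl })
  δ-↔ zero    (suc q) = mk↔ₛ′ (λ ()) (λ ()) (λ ()) (λ ())
  δ-↔ (suc n) zero    = mk↔ₛ′ (λ ()) (λ ()) (λ ()) (λ ())
  δ-↔ (suc n) (suc q) = mk↔ₛ′ (cong suc) suc-injective (λ p → ≡-irrelevant _ p) (λ p → ≡-irrelevant _ p) ↔-∘ δ-↔ n q

  opaque
    unfolding sumParts

    sumParts-↔ : ∀ (c : ℕ → ℕ) m {f : ℕ → ℕ} {B : ℕ → Set} → (∀ i → Fin (f i) ↔ B i) →
      Fin (sumParts c m f) ↔ (Σ[ j ∈ Fin m ] Fin (c (suc (toℕ j))) × B (toℕ j))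
    sumParts-↔ c m {f} {B} f↔B = ∑-↔ {B = λ j → Fin (c (suc (toℕ j))) × B (toℕ j)} λ j → (↔-id _ ×-↔ f↔B (toℕ j)) ↔-∘ *↔×

  -- `S` identifies elements that differ only in their admissibility proofs, whereas `A` has plain
  -- equality. It is therefore enough that `to` be injective and surjective up to `≈`; the inverse
  -- comes from the chosen preimages.
  cardinality : ∀ (S : Setoid 0ℓ 0ℓ) {A : Set} {m} (let open Setoid S) → Fin m ↔ A → (to : A → Carrier) →
    (∀ x y → to x ≈ to y → x ≡ y) → (∀ s → ∃[ x ] to x ≈ s) → HasCardinality S m
  cardinality S {A} m↔A to inj surj = record
    { to        = to ∘ M.to
    ; from      = from
    ; to-cong   = λ { refl → S.refl }
    ; from-cong = λ {s} {t} s≈t → cong M.from (inj _ _ (S.trans (proj₂ (surj s)) (S.trans s≈t (S.sym (proj₂ (surj t))))))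
    ; inverse   = (λ {s} i≡ → S.trans (S.reflexive (cong to (M.inverseˡ i≡))) (proj₂ (surj s)))
                , (λ {i} {s} s≈ → M.inverseʳ (inj _ _ (S.trans (proj₂ (surj s)) s≈)))
    }
    where
    module S = Setoid S
    module M = Inverse m↔A
    from : S.Carrier → _
    from s = M.from (proj₁ (surj s))

  -- IsDyck, read letter by letter, for a word starting at height h.
  Descends : ℕ → List Step → Set
  Descends h       []      = h ≡ 0
  Descends h       (u ∷ w) = Descends (suc h) w
  Descends zero    (d ∷ w) = ⊥
  Descends (suc h) (d ∷ w) = Descends h w

  -- `h` is the surplus of `u` over `d` in the letters already read, so that the hypotheses pass to
  -- the tail. A `d` at height 0 is refuted by the one-letter prefix.
  dyck⇒descends : ∀ h w → (∀ p q → p ++ q ≡ w → #d p ≤ h + #u p) → #d w ≡ h + #u w → Descends h w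
  dyck⇒descends h       []      pre eq = trans (sym (+-identityʳ h)) (sym eq)
  dyck⇒descends h       (u ∷ w) pre eq = dyck⇒descends (suc h) w
    (λ p q p++q≡w → subst (#d p ≤_) (+-suc h (#u p)) (pre (u ∷ p) q (cong (u ∷_) p++q≡w))) (trans eq (+-suc h (#u w)))
  dyck⇒descends zero    (d ∷ w) pre eq = contradiction (pre (d ∷ []) w refl) λ ()
  dyck⇒descends (suc h) (d ∷ w) pre eq = dyck⇒descends h w
    (λ p q p++q≡w → ≤-pred (pre (d ∷ p) q (cong (d ∷_) p++q≡w))) (suc-injective eq)

  descends⇒prefix : ∀ h w → Descends h w → ∀ p q → p ++ q ≡ w → #d p ≤ h + #u p
  descends⇒prefix h       w       s []      q eq   = z≤n
  descends⇒prefix h       (u ∷ w) s (u ∷ p) q refl = subst (#d p ≤_) (sym (+-suc h (#u p))) (descends⇒prefix (suc h) w s p q refl)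
  descends⇒prefix (suc h) (d ∷ w) s (d ∷ p) q refl = s≤s (descends⇒prefix h w s p q refl)

  descends⇒#d : ∀ h w → Descends h w → #d w ≡ h + #u w
  descends⇒#d h       []      s = sym (trans (+-identityʳ h) s)
  descends⇒#d h       (u ∷ w) s = trans (descends⇒#d (suc h) w s) (sym (+-suc h (#u w)))
  descends⇒#d (suc h) (d ∷ w) s = cong suc (descends⇒#d h w s)

  descends-ascent : ∀ x h w → Descends h (replicate x u ++ w) ≡ Descends (x + h) w
  descends-ascent zero    h w = refl
  descends-ascent (suc x) h w = trans (descends-ascent x (suc h) w) (cong (λ z → Descends z w) (+-suc x h))

  descends-descent : ∀ y h w → Descends (y + h) (replicate y d ++ w) ≡ Descends h w
  descends-descent zero    h w = refl
  descends-descent (suc y) h w = descends-descent y h w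

  peaks-descent : ∀ y w → peaks (replicate y d ++ w) ≡ peaks w
  peaks-descent zero    w = refl
  peaks-descent (suc y) w = peaks-descent y w

  peaks-ascent : ∀ x w → peaks (replicate (suc x) u ++ d ∷ w) ≡ suc (peaks w)
  peaks-ascent zero    w = refl
  peaks-ascent (suc x) w = peaks-ascent x w

  ascents-ascent : ∀ x r w → ascentsAfter r (replicate x u ++ w) ≡ ascentsAfter (x + r) w
  ascents-ascent zero    r       w = refl
  ascents-ascent (suc x) zero    w = trans (ascents-ascent x 1 w) (cong (λ z → ascentsAfter z w) (+-suc x 0))
  ascents-ascent (suc x) (suc r) w = trans (ascents-ascent x (suc (suc r)) w) (cong (λ z → ascentsAfter z w) (+-suc x (suc r)))

  ascents-descent : ∀ y w → ascents (replicate y d ++ w) ≡ ascents w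
  ascents-descent zero    w = refl
  ascents-descent (suc y) w = ascents-descent y w

  #u-++ : ∀ v w → #u (v ++ w) ≡ #u v + #u w
  #u-++ v w = trans (cong length (filter-++ (_≟ˢ u) v w)) (length-++ (filter (_≟ˢ u) v))

  #u-ascent : ∀ x → #u (replicate x u) ≡ x
  #u-ascent zero    = refl
  #u-ascent (suc x) = cong suc (#u-ascent x)

  #u-descent : ∀ y → #u (replicate y d) ≡ 0
  #u-descent zero    = refl
  #u-descent (suc y) = #u-descent y

  -- Colourings of equal words have different types as long as the equality is only propositional.
  -- Their lists of numbers can be compared without transport, and `erase-injective` shows that
  -- nothing is lost.
  erase : ∀ {f : ℕ → ℕ} {ls} → All (Fin ∘ f) ls → List ℕ
  erase = All.reduce toℕ

  erase-injective : ∀ {f : ℕ → ℕ} {ls} (xs ys : All (Fin ∘ f) ls) → erase xs ≡ erase ys → xs ≡ ys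
  erase-injective []       []       eq = refl
  erase-injective (x ∷ xs) (y ∷ ys) eq =
    cong₂ _∷_ (toℕ-injective (∷-injectiveˡ eq)) (erase-injective xs ys (∷-injectiveʳ eq))

  erase-subst : ∀ {f : ℕ → ℕ} {ls ls′} (eq : ls ≡ ls′) (xs : All (Fin ∘ f) ls) → erase (subst (All (Fin ∘ f)) eq xs) ≡ erase xs
  erase-subst refl xs = refl

  module _ (a b : ℕ) .{{_ : NonZero (a + b)}} where

    -- Makes a first `u` and the `d` after the ascent visible as constructors, so that functions
    -- reading the word can compute; that there is a `u` at all uses `a + b ≠ 0`.
    P-shape : ∀ j w → P a b (suc j) ++ w ≡
      replicate (suc (pred ((a + b) * suc j))) u ++ d ∷ replicate (b * j) d ++ w
    P-shape j w = begin
      (replicate ((a + b) * suc j) u ++ replicate (b * j + 1) d) ++ w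
        ≡⟨ ++-assoc (replicate ((a + b) * suc j) u) _ w ⟩
      replicate ((a + b) * suc j) u ++ replicate (b * j + 1) d ++ w
        ≡⟨ cong₂ (λ x y → replicate x u ++ replicate y d ++ w) (sym (suc-pred ((a + b) * suc j) {{m*n≢0 (a + b) (suc j)}})) (+-comm (b * j) 1) ⟩
      replicate (suc (pred ((a + b) * suc j))) u ++ d ∷ replicate (b * j) d ++ w ∎

    -- The block turns once and ends in `d`, so no peak straddles the seam with `w`.
    peaks-P : ∀ j w → peaks (P a b (suc j) ++ w) ≡ suc (peaks w)
    peaks-P j w = begin
      peaks (P a b (suc j) ++ w) ≡⟨ cong peaks (P-shape j w) ⟩
      peaks (replicate (suc (pred ((a + b) * suc j))) u ++ d ∷ replicate (b * j) d ++ w) ≡⟨ peaks-ascent (pred ((a + b) * suc j)) _ ⟩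
      suc (peaks (replicate (b * j) d ++ w)) ≡⟨ cong suc (peaks-descent (b * j) w) ⟩
      suc (peaks w) ∎

    ascents-P : ∀ j w → ascents (P a b (suc j) ++ w) ≡ (a + b) * suc j ∷ ascents w
    ascents-P j w = begin
      ascents (P a b (suc j) ++ w)
        ≡⟨ cong ascents (P-shape j w) ⟩
      ascents (replicate (suc x) u ++ d ∷ replicate (b * j) d ++ w)
        ≡⟨ ascents-ascent (suc x) 0 _ ⟩
      suc (x + 0) ∷ ascents (replicate (b * j) d ++ w)
        ≡⟨ cong₂ _∷_ (trans (cong suc (+-identityʳ x)) (suc-pred ((a + b) * suc j) {{m*n≢0 (a + b) (suc j)}})) (ascents-descent (b * j) w) ⟩
      (a + b) * suc j ∷ ascents w ∎
      where
      x : ℕ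
      x = pred ((a + b) * suc j)

    #u-P : ∀ j w → #u (P a b (suc j) ++ w) ≡ (a + b) * suc j + #u w
    #u-P j w = begin
      #u ((replicate x u ++ replicate (b * j + 1) d) ++ w)
        ≡⟨ trans (#u-++ (replicate x u ++ replicate (b * j + 1) d) w) (cong (_+ #u w) (#u-++ (replicate x u) _)) ⟩
      #u (replicate x u) + #u (replicate (b * j + 1) d) + #u w
        ≡⟨ cong (_+ #u w) (trans (cong₂ _+_ (#u-ascent x) (#u-descent (b * j + 1))) (+-identityʳ x)) ⟩
      x + #u w ∎
      where
      x : ℕ
      x = (a + b) * suc j

    -- The condition inside the block is automatic: the descent follows the whole ascent and stops
    -- at `h + rise`, which is at least `h`.
    descends-P : ∀ c m j h w → Descends h (P a b (suc j) ++ w) ≡ Descends (h + rise a b c m j) w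
    descends-P c m j h w = begin
      Descends h ((replicate x u ++ replicate y d) ++ w) ≡⟨ cong (Descends h) (++-assoc (replicate x u) (replicate y d) w) ⟩
      Descends h (replicate x u ++ replicate y d ++ w)   ≡⟨ descends-ascent x h _ ⟩
      Descends (x + h) (replicate y d ++ w)              ≡⟨ cong (λ z → Descends z (replicate y d ++ w)) balance ⟩
      Descends (y + (h + r)) (replicate y d ++ w)        ≡⟨ descends-descent y (h + r) w ⟩
      Descends (h + r) w                                 ∎
      where
      x y r : ℕ
      x = (a + b) * suc j
      y = b * j + 1
      r = rise a b c m j
      balance : x + h ≡ y + (h + r)
      balance = begin
        (a + b) * suc j + h               ≡⟨ rearrange a b j h ⟩
        b * j + (h + (a * suc j + b))     ≡⟨ cong (λ z → b * j + (h + z)) (suc-rise a b c m j) ⟨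
        b * j + (h + suc r)               ≡⟨ rearrange′ (b * j) h r ⟩
        b * j + 1 + (h + r)               ∎
        where
        rearrange : ∀ a b j h → (a + b) * suc j + h ≡ b * j + (h + (a * suc j + b))
        rearrange = solve-∀
        rearrange′ : ∀ y h r → y + (h + suc r) ≡ y + 1 + (h + r)
        rearrange′ = solve-∀

  -- Lists of coloured blocks as intermediary between walks and words.

  module _ (a b : ℕ) .{{_ : NonZero (a + b)}} (c : ℕ → ℕ) (n : ℕ) where

    private
      rise′ = rise a b c n

    -- H is the current height plus one, k the number of blocks P_j with j ≥ 1 still to come,
    -- and Φ constrains the sum of their indices j.
    Walk : ℕ → ℕ → (ℕ → Set) → Set
    Walk H       zero    Φ = Φ 0
    Walk zero    (suc k) Φ = ⊥
    Walk (suc H) (suc k) Φ = Walk H (suc k) Φ ⊎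
      (Σ[ j ∈ Fin n ] Fin (c (suc (toℕ j))) × Walk (suc (H + rise′ (toℕ j))) k (shift (suc (toℕ j)) Φ))

    walks-↔ : ∀ H k {φ Φ} → (∀ q → Fin (φ q) ↔ Φ q) → Fin (walks a b c n H k φ) ↔ Walk H k Φ
    walks-↔ H       zero    φ↔Φ = φ↔Φ 0
    walks-↔ zero    (suc k) φ↔Φ = 0↔⊥
    walks-↔ (suc H) (suc k) {Φ = Φ} φ↔Φ =
      (walks-↔ H (suc k) φ↔Φ ⊎-↔
        sumParts-↔ c n {B = λ i → Walk (suc (H + rise′ i)) k (shift (suc i) Φ)}
          (λ i → walks-↔ (suc (H + rise′ i)) k (λ q → φ↔Φ (suc i + q))))
      ↔-∘ +↔⊎

    -- The colour sits on the block and not on an ascent of the word, so a list of blocks is free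
    -- data; `colours` carries it over to the ascents.
    data Block : Set where
      down : Block
      jump : (j : Fin n) → Fin (c (suc (toℕ j))) → Block

    index : Block → Fin (suc n)
    index down       = zero
    index (jump j x) = suc j

    jumps : List Block → ℕ
    jumps []              = 0
    jumps (down ∷ bs)     = jumps bs
    jumps (jump j x ∷ bs) = suc (jumps bs)

    total : List Block → ℕ
    total []              = 0
    total (down ∷ bs)     = total bs
    total (jump j x ∷ bs) = suc (toℕ j) + total bs

    concatP : List (Fin (suc n)) → List Step
    concatP = concatMap (P a b ∘ toℕ)

    wordOf : List Block → List Step
    wordOf bs = concatP (map index bs)

    blocksOf : ∀ H k {Φ} → Walk H k Φ → List Block
    -- The height is `H - 1`, and this many blocks `P_0` form the forced final descent.
    blocksOf H       zero    p                  = replicate (pred H) down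
    blocksOf (suc H) (suc k) (inj₁ p)           = down ∷ blocksOf H (suc k) p
    blocksOf (suc H) (suc k) (inj₂ (j , x , p)) = jump j x ∷ blocksOf (suc (H + rise′ (toℕ j))) k p

    jumps-downs : ∀ h → jumps (replicate h down) ≡ 0
    jumps-downs zero    = refl
    jumps-downs (suc h) = jumps-downs h

    total-downs : ∀ h → total (replicate h down) ≡ 0
    total-downs zero    = refl
    total-downs (suc h) = total-downs h

    descends-downs : ∀ h → Descends h (wordOf (replicate h down))
    descends-downs zero    = refl
    descends-downs (suc h) = descends-downs h

    jumps-blocksOf : ∀ H k {Φ} (p : Walk H k Φ) → jumps (blocksOf H k p) ≡ k
    jumps-blocksOf H       zero    p                  = jumps-downs (pred H)
    jumps-blocksOf (suc H) (suc k) (inj₁ p)           = jumps-blocksOf H (suc k) p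
    jumps-blocksOf (suc H) (suc k) (inj₂ (j , x , p)) = cong suc (jumps-blocksOf _ k p)

    total-blocksOf : ∀ H k {Φ} (p : Walk H k Φ) → Φ (total (blocksOf H k p))
    total-blocksOf H       zero {Φ}    p                  = subst Φ (sym (total-downs (pred H))) p
    total-blocksOf (suc H) (suc k)     (inj₁ p)           = total-blocksOf H (suc k) p
    total-blocksOf (suc H) (suc k)     (inj₂ (j , x , p)) = total-blocksOf _ k p

    descends-blocksOf : ∀ h k {Φ} (p : Walk (suc h) k Φ) → Descends h (wordOf (blocksOf (suc h) k p))
    descends-blocksOf h       zero    p                  = descends-downs h
    descends-blocksOf (suc h) (suc k) (inj₁ p)           = descends-blocksOf h (suc k) p
    descends-blocksOf h       (suc k) (inj₂ (j , x , p)) =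
      subst (λ A → A) (sym (descends-P a b c n (toℕ j) h _)) (descends-blocksOf (h + rise′ (toℕ j)) k p)

    jump-injective : ∀ {j j′ : Fin n} {x x′} {bs bs′ : List Block} → jump j x ∷ bs ≡ jump j′ x′ ∷ bs′ →
      Σ[ eq ∈ j ≡ j′ ] subst (λ j → Fin (c (suc (toℕ j)))) eq x ≡ x′ × bs ≡ bs′
    jump-injective refl = refl , refl , refl

    -- The block list forgets only the evidence for `Φ`, hence the hypothesis that such evidence is
    -- unique.
    blocksOf-injective : ∀ H k {Φ} → (∀ q (x y : Φ q) → x ≡ y) → (p p′ : Walk H k Φ) →
      blocksOf H k p ≡ blocksOf H k p′ → p ≡ p′
    blocksOf-injective H       zero    irr p        p′        eq = irr 0 p p′
    blocksOf-injective (suc H) (suc k) irr (inj₁ p) (inj₁ p′) eq =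
      cong inj₁ (blocksOf-injective H (suc k) irr p p′ (∷-injectiveʳ eq))
    blocksOf-injective (suc H) (suc k) irr (inj₂ (j , x , p)) (inj₂ (j′ , x′ , p′)) eq with jump-injective eq
    ... | refl , refl , eq′ = cong (λ p → inj₂ (j , x , p)) (blocksOf-injective _ k (λ q → irr (suc (toℕ j) + q)) p p′ eq′)

    blocksOf-surjective : ∀ h bs {Φ} → Descends h (wordOf bs) → Φ (total bs) →
      Σ[ p ∈ Walk (suc h) (jumps bs) Φ ] blocksOf (suc h) (jumps bs) p ≡ bs
    blocksOf-surjective h       []              refl Φ₀ = Φ₀ , refl
    blocksOf-surjective (suc h) (down ∷ bs)     s    Φₜ with jumps bs | blocksOf-surjective h bs s Φₜ
    -- Without a later jump the leading `down` belongs to the forced descent and leaves no trace in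
    -- the walk; otherwise it is a recorded step.
    ... | zero  | p , eq = p , cong (down ∷_) eq
    ... | suc k | p , eq = inj₁ p , cong (down ∷_) eq
    blocksOf-surjective h       (jump j x ∷ bs) s    Φₜ
      with p , eq ← blocksOf-surjective (h + rise′ (toℕ j)) bs (subst (λ A → A) (descends-P a b c n (toℕ j) h (wordOf bs)) s) Φₜ
      = inj₂ (j , x , p) , cong (jump j x ∷_) eq

    jumps≤total : ∀ bs → jumps bs ≤ total bs
    jumps≤total []              = z≤n
    jumps≤total (down ∷ bs)     = jumps≤total bs
    jumps≤total (jump j x ∷ bs) = s≤s (m≤n⇒m≤o+n (toℕ j) (jumps≤total bs))

    jumps≡0⇒total≡0 : ∀ bs → jumps bs ≡ 0 → total bs ≡ 0
    jumps≡0⇒total≡0 []          eq = refl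
    jumps≡0⇒total≡0 (down ∷ bs) eq = jumps≡0⇒total≡0 bs eq

    peaks-wordOf : ∀ bs → peaks (wordOf bs) ≡ jumps bs
    peaks-wordOf []              = refl
    peaks-wordOf (down ∷ bs)     = peaks-wordOf bs
    peaks-wordOf (jump j x ∷ bs) = trans (peaks-P a b (toℕ j) (wordOf bs)) (cong suc (peaks-wordOf bs))

    #u-wordOf : ∀ bs → #u (wordOf bs) ≡ (a + b) * total bs
    #u-wordOf []              = sym (*-zeroʳ (a + b))
    #u-wordOf (down ∷ bs)     = #u-wordOf bs
    #u-wordOf (jump j x ∷ bs) = trans (#u-P a b (toℕ j) (wordOf bs))
      (trans (cong ((a + b) * suc (toℕ j) +_) (#u-wordOf bs)) (sym (*-distribˡ-+ (a + b) (suc (toℕ j)) (total bs))))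

    ascent-colours : ∀ j → c (((a + b) * suc j) div (a + b)) ≡ c (suc j)
    ascent-colours j = cong c (trans (cong (_div (a + b)) (*-comm (a + b) (suc j))) (m*n/n≡m (suc j) (a + b)))

    colours : ∀ bs → Colouring a b c (wordOf bs)
    colours []              = []
    colours (down ∷ bs)     = colours bs
    colours (jump j x ∷ bs) = subst (All _) (sym (ascents-P a b (toℕ j) (wordOf bs)))
      (Fin.cast (sym (ascent-colours (toℕ j))) x ∷ colours bs)

    erase-colours : ∀ j x bs → erase (colours (jump j x ∷ bs)) ≡ toℕ x ∷ erase (colours bs)
    erase-colours j x bs = trans (erase-subst (sym (ascents-P a b (toℕ j) (wordOf bs))) _)
      (cong (_∷ erase (colours bs)) (toℕ-cast (sym (ascent-colours (toℕ j))) x))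

    Coloured : Set
    Coloured = Σ (List Step) (Colouring a b c)

    coloured : List Block → Coloured
    coloured bs = wordOf bs , colours bs

    coloured-≡ : ∀ {w w′} {x : Colouring a b c w} {x′ : Colouring a b c w′} →
      w ≡ w′ → erase x ≡ erase x′ → _≡_ {A = Coloured} (w , x) (w′ , x′)
    coloured-≡ {x = x} {x′} refl eq = cong (_ ,_) (erase-injective x x′ eq)

    -- The factorisation is unique: a first letter `d` can only come from `P_0`, while after a first
    -- letter `u` the length `(a + b) j` of the first ascent determines `j`, as `a + b ≠ 0`.
    wordOf-erase-injective : ∀ bs bs′ → wordOf bs ≡ wordOf bs′ → erase (colours bs) ≡ erase (colours bs′) → bs ≡ bs′
    wordOf-erase-injective [] [] w≡ x≡ = refl
    wordOf-erase-injective [] (jump j x ∷ bs′) w≡ x≡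
      with () ← trans w≡ (P-shape a b (toℕ j) (wordOf bs′))
    wordOf-erase-injective (down ∷ bs) (down ∷ bs′) w≡ x≡ =
      cong (down ∷_) (wordOf-erase-injective bs bs′ (∷-injectiveʳ w≡) x≡)
    wordOf-erase-injective (down ∷ bs) (jump j x ∷ bs′) w≡ x≡
      with () ← trans w≡ (P-shape a b (toℕ j) (wordOf bs′))
    wordOf-erase-injective (jump j x ∷ bs) [] w≡ x≡
      with () ← trans (sym w≡) (P-shape a b (toℕ j) (wordOf bs))
    wordOf-erase-injective (jump j x ∷ bs) (down ∷ bs′) w≡ x≡
      with () ← trans (sym w≡) (P-shape a b (toℕ j) (wordOf bs))
    wordOf-erase-injective (jump j x ∷ bs) (jump j′ x′ ∷ bs′) w≡ x≡
      with refl ← toℕ-injective (suc-injective (*-cancelˡ-≡ (suc (toℕ j)) (suc (toℕ j′)) (a + b) (∷-injectiveˡ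
             (trans (sym (ascents-P a b (toℕ j) (wordOf bs))) (trans (cong ascents w≡) (ascents-P a b (toℕ j′) (wordOf bs′)))))))
      = cong₂ (λ x bs → jump j x ∷ bs) (toℕ-injective (∷-injectiveˡ x≡′))
          (wordOf-erase-injective bs bs′ (++-cancelˡ (P a b (suc (toℕ j))) (wordOf bs) (wordOf bs′) w≡) (∷-injectiveʳ x≡′))
      where
      x≡′ : toℕ x ∷ erase (colours bs) ≡ toℕ x′ ∷ erase (colours bs′)
      x≡′ = trans (sym (erase-colours j x bs)) (trans x≡ (erase-colours j x′ bs′))

    coloured-injective : ∀ bs bs′ → coloured bs ≡ coloured bs′ → bs ≡ bs′
    coloured-injective bs bs′ eq = wordOf-erase-injective bs bs′ (cong proj₁ eq) (cong (erase ∘ proj₂) eq)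

    -- Surjectivity on colourings: `ascents-P` exposes the colour of the first ascent, which is then
    -- attached to the block that made it.
    colour-blocks : ∀ js (x : Colouring a b c (concatP js)) → ∃[ bs ] map index bs ≡ js × erase (colours bs) ≡ erase x
    colour-blocks []           []      = [] , refl , refl
    colour-blocks (zero ∷ js)  x       with bs , refl , eq ← colour-blocks js x = down ∷ bs , refl , eq
    colour-blocks (suc j ∷ js) x
      with subst (All _) (ascents-P a b (toℕ j) (concatP js)) x in eq
    ... | y ∷ ys with bs , refl , eq′ ← colour-blocks js ys = jump j y′ ∷ bs , refl , (begin
      erase (colours (jump j y′ ∷ bs))  ≡⟨ erase-colours j y′ bs ⟩
      toℕ y′ ∷ erase (colours bs)       ≡⟨ cong₂ _∷_ (toℕ-cast (ascent-colours (toℕ j)) y) eq′ ⟩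
      erase (y ∷ ys)                    ≡⟨ cong erase eq ⟨
      erase (subst (All _) (ascents-P a b (toℕ j) (concatP js)) x) ≡⟨ erase-subst (ascents-P a b (toℕ j) (concatP js)) x ⟩
      erase x                           ∎)
      where
      y′ : Fin (c (suc (toℕ j)))
      y′ = Fin.cast (ascent-colours (toℕ j)) y

    toDyck : ∀ bs → Descends 0 (wordOf bs) → total bs ≡ n → ColouredDyckWord a b c n
    toDyck bs s total≡n = record
      { word      = wordOf bs
      ; dyck      = record { ups = #u≡ ; downs = trans (descends⇒#d 0 (wordOf bs) s) #u≡ ; prefix = descends⇒prefix 0 (wordOf bs) s }
      ; blocks    = map index bs , refl
      ; colouring = colours bs
      }
      where
      #u≡ : #u (wordOf bs) ≡ (a + b) * n
      #u≡ = trans (#u-wordOf bs) (cong ((a + b) *_) total≡n)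

    -- The semilength fixes the total of the indices: the blocks contain `(a + b) * total` letters
    -- `u`, and `a + b` cancels.
    fromDyck : ∀ (w : ColouredDyckWord a b c n) →
      ∃[ bs ] coloured bs ≡ wordAndColours a b c n w × Descends 0 (wordOf bs) × total bs ≡ n
    fromDyck record { word = _ ; dyck = dyck ; blocks = js , refl ; colouring = x }
      with bs , refl , eq ← colour-blocks js x = bs , coloured-≡ refl eq
        , dyck⇒descends 0 (wordOf bs) (IsDyck.prefix dyck) (trans (IsDyck.downs dyck) (sym (IsDyck.ups dyck)))
        , *-cancelˡ-≡ (total bs) n (a + b) (trans (sym (#u-wordOf bs)) (IsDyck.ups dyck))

    walkDyck : ∀ k → Walk 1 k (_≡ n) → ColouredDyckWord a b c n
    walkDyck k p = toDyck (blocksOf 1 k p) (descends-blocksOf 0 k p) (total-blocksOf 1 k p)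

    peaks-walkDyck : ∀ k p → peaks (word (walkDyck k p)) ≡ k
    peaks-walkDyck k p = trans (peaks-wordOf (blocksOf 1 k p)) (jumps-blocksOf 1 k p)

    walkDyck-injective : ∀ k p p′ → wordAndColours a b c n (walkDyck k p) ≡ wordAndColours a b c n (walkDyck k p′) → p ≡ p′
    walkDyck-injective k p p′ eq = blocksOf-injective 1 k (λ q → ≡-irrelevant) p p′ (coloured-injective _ _ eq)

    -- The number of jumps is dictated by the word, being its number of peaks; one statement
    -- therefore serves both the count with fixed `k` and the full count.
    walkDyck-surjective : ∀ w → Σ[ p ∈ Walk 1 (peaks (word w)) (_≡ n) ]
      wordAndColours a b c n (walkDyck (peaks (word w)) p) ≡ wordAndColours a b c n w
    walkDyck-surjective w with bs , eq , s , t ← fromDyck w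
      with p , eq′ ← blocksOf-surjective 0 bs {_≡ n} s t =
      subst (λ k → Σ[ p ∈ Walk 1 k (_≡ n) ] wordAndColours a b c n (walkDyck k p) ≡ wordAndColours a b c n w)
        (trans (sym (peaks-wordOf bs)) (cong (peaks ∘ proj₁) eq)) (p , trans (cong coloured eq′) eq)

    -- A word without jumps has total 0, excluded by `1 ≤ n`. Each jump contributes at least 1 to
    -- the total `n`, so there are at most `n` of them.
    peaks-bounds : 1 ≤ n → ∀ (w : ColouredDyckWord a b c n) → ∃[ i ] peaks (word w) ≡ suc (toℕ {n} i)
    peaks-bounds 1≤n w with bs , eq , s , t ← fromDyck w = go (peaks (word w)) (trans (cong (peaks ∘ proj₁) (sym eq)) (peaks-wordOf bs))
      where
      go : ∀ k → k ≡ jumps bs → ∃[ i ] k ≡ suc (toℕ {n} i)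
      go zero    k≡ = contradiction (trans (sym t) (jumps≡0⇒total≡0 bs (sym k≡))) (≢-sym (<⇒≢ 1≤n))
      go (suc k) k≡ = fromℕ< k<n , cong suc (sym (toℕ-fromℕ< k<n))
        where
        k<n : k < n
        k<n = subst₂ _≤_ (sym k≡) t (jumps≤total bs)

    𝔇-withPeaks-cardinality : ∀ k → HasCardinality (𝔇-withPeaks a b c n k) (walks a b c n 1 k (δ n))
    𝔇-withPeaks-cardinality k = cardinality (𝔇-withPeaks a b c n k) (walks-↔ 1 k (δ-↔ n))
      (λ p → walkDyck k p , peaks-walkDyck k p) (walkDyck-injective k) (λ { (w , refl) → walkDyck-surjective w })

    𝔇-cardinality : 1 ≤ n → HasCardinality (𝔇 a b c n) (∑ {n} λ i → walks a b c n 1 (suc (toℕ i)) (δ n))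
    𝔇-cardinality 1≤n = cardinality (𝔇 a b c n)
      (∑-↔ {B = λ i → Walk 1 (suc (toℕ i)) (_≡ n)} λ i → walks-↔ 1 (suc (toℕ i)) (δ-↔ n))
      dyckOf injective surjective
      where
      dyckOf : Σ[ i ∈ Fin n ] Walk 1 (suc (toℕ i)) (_≡ n) → ColouredDyckWord a b c n
      dyckOf (i , p) = walkDyck (suc (toℕ i)) p
      injective : ∀ x y → wordAndColours a b c n (dyckOf x) ≡ wordAndColours a b c n (dyckOf y) → x ≡ y
      injective (i , p) (i′ , p′) eq
        -- The word remembers `i` as its number of peaks minus one, so the classes for different `i`
        -- are disjoint.
        with refl ← toℕ-injective {i = i} {i′} (suc-injective (begin
               suc (toℕ i)                             ≡⟨ peaks-walkDyck (suc (toℕ i)) p ⟨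
               peaks (word (dyckOf (i , p)))           ≡⟨ cong (peaks ∘ proj₁) eq ⟩
               peaks (word (dyckOf (i′ , p′)))         ≡⟨ peaks-walkDyck (suc (toℕ i′)) p′ ⟩
               suc (toℕ i′)                            ∎))
        = cong (i ,_) (walkDyck-injective (suc (toℕ i)) p p′ eq)
      surjective : ∀ w → ∃[ x ] wordAndColours a b c n (dyckOf x) ≡ wordAndColours a b c n w
      surjective w with i , eq ← peaks-bounds 1≤n w
        with p , eq′ ← subst (λ k → Σ[ p ∈ Walk 1 k (_≡ n) ] wordAndColours a b c n (walkDyck k p) ≡ wordAndColours a b c n w)
               eq (walkDyck-surjective w)
        = (i , p) , eq′

open import Data.Nat using (ℕ; suc; _+_; _≤_; NonZero; z≤n; s≤s)
open import Data.Fin using (toℕ)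
open import Data.Fin.Properties using (toℕ<n)
open import Data.Product using (_×_; ∃-syntax; _,_)
open import Data.Rational using (+-*-rawSemiring)
open import Data.Rational.Properties using (+-*-commutativeRing)
open import Algebra.Bundles using (CommutativeRing)
open import Algebra.Definitions.RawSemiring +-*-rawSemiring using (sum)
open import Algebra.Properties.Semiring.Sum (CommutativeRing.semiring +-*-commutativeRing) using (sum-cong-≗)
open import Relation.Binary.PropositionalEquality using (_≡_; trans)
open PartialBell using (fromℕ-∑; summand-walks)
open WalksAndWords using (𝔇-cardinality; 𝔇-withPeaks-cardinality)

theorem3p5 : (a b : ℕ) .{{_ : NonZero (a + b)}} (c : ℕ → ℕ) (n : ℕ) → 1 ≤ n →
    (∃[ y ] HasCardinality (𝔇 a b c n) y × fromℕ y ≡ sum {n} (λ i → summand a b c n (suc (toℕ i)))) ×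
    ((k : ℕ) → 1 ≤ k → k ≤ n → ∃[ N ] HasCardinality (𝔇-withPeaks a b c n k) N × fromℕ N ≡ summand a b c n k)
theorem3p5 a b c n 1≤n =
  -- The count is the sum of the walk numbers over the possible numbers of peaks, and each of them
  -- is identified with its summand separately.
  (_ , 𝔇-cardinality a b c n 1≤n , trans (fromℕ-∑ {n} _)
    (sum-cong-≗ {n} λ i → summand-walks c a b n (suc (toℕ i)) (s≤s z≤n) (toℕ<n i))) ,
  λ k 1≤k k≤n → _ , 𝔇-withPeaks-cardinality a b c n k , summand-walks c a b n k 1≤k k≤n
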